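{- There exists a family $(P_k)_{k\in\mathbb N}$ of polynomials on $\mathbb N$ such that, whenever $\pi$ is a derivation in $\mathrm{SAL}\omega$ of a judgment $\vdash t:A\mid$ (with empty context), the term $t$ normalizes in at most $P_{\delta(\pi)}(|t|)$ reduction steps, where $\delta(\pi)$ is the depth of $\pi$ and $|t|$ is the size of $t$.
   Context: **Terms.** There are positive variables $x,y,\dots$ and negative variables $\alpha,\beta,\dots$; $\kappa,\kappa'$ denote variables of either polarity; further constants $k_+\in\mathcal K_+,k_-\in\mathcal K_-$ may be present (they have no typing rule). Grammar: positive values $V_+::=x\mid (V,V')\mid\{V\}\mid\,!V\mid k_+$; values $V::=V_+\mid t_-$; positive terms $t_+::=V_+\mid\mu\alpha.c$; negative terms $t_-::=\alpha\mid\mu(\kappa,\kappa').c\ (\kappa\ne\kappa')\mid\mu\{\kappa\}.c\mid\mu!(\kappa).c\mid\mu x.c\mid k_-$; commands $c::=\langle t_+|t_-\rangle$, where $\langle t|u\rangle$ and $\langle u|t\rangle$ are identified. Everything is up to $\alpha$-equivalence; $|t|$ is the number of symbols of $t$. For a value $V$ and positive variables: $!^{\alpha}_{\emptyset}V=\langle !V|\alpha\rangle$, $!^{\alpha}_{S\cup\{x\}}V=\langle\mu!(x).(!^{\alpha}_SV)\,|\,x\rangle$, and $!_SV=\mu\alpha.(!^\alpha_SV)$ with $\alpha$ a fresh negative variable. **Reduction** (on whole commands, not under binders): $\langle\mu\alpha.c|t_-\rangle\to_\mu c[t_-/\alpha]$; $\langle V_+|\mu x.c\rangle\to_\mu c[V_+/x]$;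 $\langle\{V\}|\mu\{\kappa\}.c\rangle\to_\beta c[V/\kappa]$; $\langle(V,V')|\mu(\kappa,\kappa').c\rangle\to_\beta c[V/\kappa,V'/\kappa']$; $\langle\mu!(\kappa).c\,|\,!V\rangle\to_!c[V/\kappa]$ (polarities of variables and values matching). Reduction is $\to_\mu\cup\to_\beta\cup\to_!$. Since reduction is defined on commands, "the term $t$ normalizes in at most $m$ steps" means that the command $\langle t|\kappa\rangle$, with $\kappa$ a fresh variable of polarity opposite to $t$, normalizes in at most $m$ steps. **Kinds and constructors.** Kinds: $\sigma,\tau::=\iota\mid o^+\mid o^-\mid\sigma\to\tau$. Constructors: $T,U,A,B::=x^\tau\mid(x^\tau)^\bot\mid\lambda x^\tau.T\mid TU\mid\mathbf 0\mid\mathbf s\mid rec_\tau\mid rec_\tau^\bot\mid A\otimes B\mid A\wp B\mid\exists x^\tau.A\mid\forall x^\tau.A\mid\downarrow A\mid\uparrow A\mid\,!A\mid\,?A$. Binders bind both $x^\tau$ and $(x^\tau)^\bot$; substituting $U$ for $x^\tau$ replaces $(x^\tau)^\bot$ by $U^\bot$. Negation on kinds: $(o^+)^\bot=o^-$, $(o^-)^\bot=o^+$, $\iota^\bot=\iota$, $(\sigma\to\tau)^\bot=\sigma\to\tau^\bot$. Involutive negation on constructors: it exchanges $x^\tau$ and $(x^\tau)^\bot$, $rec_\tau$ and $rec_\tau^\bot$; $\mathbf 0^\bot=\mathbf 0$, $\mathbf s^\bot=\mathbf s$, $(\lambda x.T)^\bot=\lambda x.T^\bot$, $(TU)^\bot=T^\bot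 U$, $(A\otimes B)^\bot=A^\bot\wp B^\bot$, $(A\wp B)^\bot=A^\bot\otimes B^\bot$, $(\forall x.A)^\bot=\exists x.A^\bot$, $(\exists x.A)^\bot=\forall x.A^\bot$, $(\uparrow A)^\bot=\downarrow A^\bot$, $(\downarrow A)^\bot=\uparrow A^\bot$, $(!A)^\bot=\,?A^\bot$, $(?A)^\bot=\,!A^\bot$. Kinding: $x^\tau:\tau$; $(x^\tau)^\bot:\tau^\bot$; $\lambda x^\sigma.T:\sigma\to\tau$ if $T:\tau$; $TU:\tau$ if $T:\sigma\to\tau,U:\sigma$; $\mathbf 0:\iota$; $\mathbf s:\iota\to\iota$; $rec_\tau:\tau\to(\iota\to\tau\to\tau)\to\iota\to\tau$; $rec_\tau^\bot:\tau\to(\iota\to\tau\to\tau)\to\iota\to\tau^\bot$; for $A,B$ of kind $o^+$ or $o^-$: $A\otimes B,\ \downarrow A,\ !A:o^+$ and $A\wp B,\ \uparrow A,\ ?A:o^-$; $\forall x^\tau.A$, $\exists x^\tau.A$ have the same kind as $A$. Formulas are constructors of kind $o^+$ (positive, $P$) or $o^-$ (negative, $N$). Convertibility $\cong$ is the least equivalence relation containing $(\lambda x.T)U\cong T\{x:=U\}$; $\lambda x.Tx\cong T$ ($x$ not free in $T$); $rec_\tau T U\mathbf 0\cong T$; $rec_\tau TU(\mathbf s n)\cong U n(rec_\tau TUn)$; $rec_\tau^\bot TU\mathbf 0\cong T^\bot$; $rec_\tau^\bot TU(\mathbf sn)\cong U^\bot n(rec_\tau TUn)$; and closed under $\lambda$,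 application, $\otimes$, $\wp$, $\exists$, $\forall$. **Typing rules of $\mathrm{SAL}\omega$.** Contexts are finite sets of declarations $x:N$ (positive variable, negative formula) or $\alpha:P$ (negative variable, positive formula). Rules (premises $\Rightarrow$ conclusion): $(Ax_+)$ $\vdash x:P\mid x:P^\bot$; $(Ax_-)$ $\vdash\alpha:N\mid\alpha:N^\bot$; $(\mu_+)$ $c:(\vdash\alpha:P,\Gamma)\Rightarrow\ \vdash\mu\alpha.c:P\mid\Gamma$; $(\mu_-)$ $c:(\vdash x:N,\Gamma)\Rightarrow\ \vdash\mu x.c:N\mid\Gamma$; $(Cut)$ $\vdash t:A\mid\Gamma$ and $\vdash u:A^\bot\mid\Delta\Rightarrow\langle t|u\rangle:(\vdash\Gamma,\Delta)$; $(\otimes)$ $\vdash V:A\mid\Gamma$ and $\vdash V':B\mid\Delta\Rightarrow\ \vdash(V,V'):A\otimes B\mid\Gamma,\Delta$; $(\wp)$ $c:(\vdash\kappa:A,\kappa':B,\Gamma)\Rightarrow\ \vdash\mu(\kappa,\kappa').c:A\wp B\mid\Gamma$; $(\downarrow)$ $\vdash V:A\mid\Gamma\Rightarrow\ \vdash\{V\}:\downarrow A\mid\Gamma$; $(\uparrow)$ $c:(\vdash\kappa:A,\Gamma)\Rightarrow\ \vdash\mu\{\kappa\}.c:\uparrow A\mid\Gamma$; $(\exists)$ $\vdash t:A[T/x^\tau]\mid\Gamma$ with $T:\tau\Rightarrow\ \vdash t:\exists x^\tau.A\mid\Gamma$; $(\forall)$ $\vdash V:A\mid\Gamma$ with $x^\tau$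 not in $\Gamma\Rightarrow\ \vdash V:\forall x^\tau.A\mid\Gamma$; $(\cong)$ $c:(\vdash\kappa:A,\Gamma)$ with $A\cong B\Rightarrow c:(\vdash\kappa:B,\Gamma)$; $(W)$ $c:(\vdash\Gamma)\Rightarrow c:(\vdash\kappa:A,\Gamma)$; $(!_k)$ for each $k\in\mathbb N$: $\vdash V:A\mid x_1:N_1,\dots,x_k:N_k\Rightarrow\ \vdash\,!_{\{x_1,\dots,x_k\}}V:\,!A\mid x_1:?N_1,\dots,x_k:?N_k$; $(M_n)$ for each $n\in\mathbb N$: $c:(\vdash\kappa_1:A,\dots,\kappa_n:A,\Gamma)\Rightarrow\ \vdash\mu!(\kappa).c[\kappa/\kappa_1,\dots,\kappa/\kappa_n]:\,?A\mid\Gamma$. In two-premise rules $\Gamma,\Delta$ are disjoint. The depth $\delta(\pi)$ is the maximal number of nested $(!_k)$ rules in $\pi$. -}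

module Defs where

open import Data.List.Base using (List; []; _∷_; _++_; replicate; map)
open import Data.List.Membership.Propositional using (_∈_)
open import Data.List.Relation.Binary.Subset.Propositional using (_⊆_)
open import Data.List.Relation.Unary.All as All using (All; []; _∷_; _[_]≔_)
open import Data.List.Relation.Unary.Any using (here; there)
open import Data.List.Relation.Unary.Unique.Propositional using (Unique)
open import Data.Maybe.Base as Maybe using (Maybe; just; nothing)
open import Data.Nat.Base using (ℕ; zero; suc; _+_; _*_; _⊔_; _≤_)
open import Data.Product.Base using (∃-syntax; _×_; _,_; proj₁; map₂)
open import Data.Sign.Base using () renaming (Sign to Polarity; + to pos; - to neg; opposite to opp)
open import Relation.Binary.PropositionalEquality.Core using (_≡_; refl; sym; cong; subst)
open import Relation.Binary.Rewriting using (IsNormalForm)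

-- Coefficients in ℕ, constant coefficient first.
Polynomial : Set
Polynomial = List ℕ

evalPoly : Polynomial → ℕ → ℕ
evalPoly []       n = 0
evalPoly (a ∷ as) n = a + n * evalPoly as n

infixr 5 _⇒_
infix  9 _⊥ᵏ

data Kind : Set where
  ι   : Kind
  o   : Polarity → Kind
  _⇒_ : Kind → Kind → Kind

_⊥ᵏ : Kind → Kind
ι       ⊥ᵏ = ι
o p     ⊥ᵏ = o (opp p)
(σ ⇒ τ) ⊥ᵏ = σ ⇒ τ ⊥ᵏ

⊥ᵏ-involutive : ∀ τ → τ ⊥ᵏ ⊥ᵏ ≡ τ
⊥ᵏ-involutive ι       = refl
⊥ᵏ-involutive (o pos) = refl
⊥ᵏ-involutive (o neg) = refl
⊥ᵏ-involutive (σ ⇒ τ) = cong (σ ⇒_) (⊥ᵏ-involutive τ)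

recKind : Kind → Kind → Kind
recKind τ ρ = τ ⇒ (ι ⇒ τ ⇒ τ) ⇒ ι ⇒ ρ

KCtx : Set
KCtx = List Kind

-- Constructors, intrinsically kinded: Con Θ τ consists of the
-- constructors of kind τ, up to α-equivalence, whose free variables are
-- among Θ.
infixl 8 _·_
infixr 7 _⊗_ _⅋_

data Con (Θ : KCtx) : Kind → Set where
  tvar        : ∀ {τ} → τ ∈ Θ → Con Θ τ
  tvar⊥       : ∀ {τ} → τ ∈ Θ → Con Θ (τ ⊥ᵏ)
  lam         : ∀ {σ τ} → Con (σ ∷ Θ) τ → Con Θ (σ ⇒ τ)
  _·_         : ∀ {σ τ} → Con Θ (σ ⇒ τ) → Con Θ σ → Con Θ τ
  𝟎           : Con Θ ι
  𝐬           : Con Θ (ι ⇒ ι)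
  rec         : ∀ τ → Con Θ (recKind τ τ)
  rec⊥        : ∀ τ → Con Θ (recKind τ (τ ⊥ᵏ))
  _⊗_         : ∀ {p q} → Con Θ (o p) → Con Θ (o q) → Con Θ (o pos)
  _⅋_         : ∀ {p q} → Con Θ (o p) → Con Θ (o q) → Con Θ (o neg)
  ∃̇ ∀̇         : ∀ τ {p} → Con (τ ∷ Θ) (o p) → Con Θ (o p)
  ↓ !         : ∀ {p} → Con Θ (o p) → Con Θ (o pos)
  ↑ ⁇         : ∀ {p} → Con Θ (o p) → Con Θ (o neg)

Form : KCtx → Polarity → Set
Form Θ p = Con Θ (o p)

infix 9 _⊥ᶜ

_⊥ᶜ : ∀ {Θ τ} → Con Θ τ → Con Θ (τ ⊥ᵏ)
tvar x ⊥ᶜ = tvar⊥ x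
_⊥ᶜ {Θ} (tvar⊥ {τ} x) = subst (Con Θ) (sym (⊥ᵏ-involutive τ)) (tvar x)
lam T ⊥ᶜ = lam (T ⊥ᶜ)
(T · U) ⊥ᶜ = T ⊥ᶜ · U
𝟎 ⊥ᶜ = 𝟎
𝐬 ⊥ᶜ = 𝐬
rec τ ⊥ᶜ = rec⊥ τ
_⊥ᶜ {Θ} (rec⊥ τ) = subst (λ ρ → Con Θ (recKind τ ρ)) (sym (⊥ᵏ-involutive τ)) (rec τ)
(A ⊗ B) ⊥ᶜ = A ⊥ᶜ ⅋ B ⊥ᶜ
(A ⅋ B) ⊥ᶜ = A ⊥ᶜ ⊗ B ⊥ᶜ
∃̇ τ A ⊥ᶜ = ∀̇ τ (A ⊥ᶜ)
∀̇ τ A ⊥ᶜ = ∃̇ τ (A ⊥ᶜ)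
↓ A ⊥ᶜ = ↑ (A ⊥ᶜ)
! A ⊥ᶜ = ⁇ (A ⊥ᶜ)
↑ A ⊥ᶜ = ↓ (A ⊥ᶜ)
⁇ A ⊥ᶜ = ! (A ⊥ᶜ)

-- Renamings are inclusions Θ ⊆ Θ′ of membership; also used for scopes of
-- term variables below.
liftRen : {A : Set} {xs ys : List A} {z : A} → xs ⊆ ys → (z ∷ xs) ⊆ (z ∷ ys)
liftRen ρ (here refl) = here refl
liftRen ρ (there x)   = there (ρ x)

renᶜ : ∀ {Θ Θ′ τ} → Θ ⊆ Θ′ → Con Θ τ → Con Θ′ τ
renᶜ ρ (tvar x)  = tvar (ρ x)
renᶜ ρ (tvar⊥ x) = tvar⊥ (ρ x)
renᶜ ρ (lam T)   = lam (renᶜ (liftRen ρ) T)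
renᶜ ρ (T · U)   = renᶜ ρ T · renᶜ ρ U
renᶜ ρ 𝟎         = 𝟎
renᶜ ρ 𝐬         = 𝐬
renᶜ ρ (rec τ)   = rec τ
renᶜ ρ (rec⊥ τ)  = rec⊥ τ
renᶜ ρ (A ⊗ B)   = renᶜ ρ A ⊗ renᶜ ρ B
renᶜ ρ (A ⅋ B)   = renᶜ ρ A ⅋ renᶜ ρ B
renᶜ ρ (∃̇ τ A)   = ∃̇ τ (renᶜ (liftRen ρ) A)
renᶜ ρ (∀̇ τ A)   = ∀̇ τ (renᶜ (liftRen ρ) A)
renᶜ ρ (↓ A)     = ↓ (renᶜ ρ A)
renᶜ ρ (! A)     = ! (renᶜ ρ A)
renᶜ ρ (↑ A)     = ↑ (renᶜ ρ A)
renᶜ ρ (⁇ A)     = ⁇ (renᶜ ρ A)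

wkᶜ : ∀ {Θ σ τ} → Con Θ τ → Con (σ ∷ Θ) τ
wkᶜ = renᶜ there

Subᶜ : KCtx → KCtx → Set
Subᶜ Θ Θ′ = ∀ {τ} → τ ∈ Θ → Con Θ′ τ

liftSubᶜ : ∀ {Θ Θ′ σ} → Subᶜ Θ Θ′ → Subᶜ (σ ∷ Θ) (σ ∷ Θ′)
liftSubᶜ s (here refl) = tvar (here refl)
liftSubᶜ s (there x)   = wkᶜ (s x)

subᶜ : ∀ {Θ Θ′ τ} → Subᶜ Θ Θ′ → Con Θ τ → Con Θ′ τ
subᶜ s (tvar x)  = s x
subᶜ s (tvar⊥ x) = s x ⊥ᶜ
subᶜ s (lam T)   = lam (subᶜ (liftSubᶜ s) T)
subᶜ s (T · U)   = subᶜ s T · subᶜ s U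
subᶜ s 𝟎         = 𝟎
subᶜ s 𝐬         = 𝐬
subᶜ s (rec τ)   = rec τ
subᶜ s (rec⊥ τ)  = rec⊥ τ
subᶜ s (A ⊗ B)   = subᶜ s A ⊗ subᶜ s B
subᶜ s (A ⅋ B)   = subᶜ s A ⅋ subᶜ s B
subᶜ s (∃̇ τ A)   = ∃̇ τ (subᶜ (liftSubᶜ s) A)
subᶜ s (∀̇ τ A)   = ∀̇ τ (subᶜ (liftSubᶜ s) A)
subᶜ s (↓ A)     = ↓ (subᶜ s A)
subᶜ s (! A)     = ! (subᶜ s A)
subᶜ s (↑ A)     = ↑ (subᶜ s A)
subᶜ s (⁇ A)     = ⁇ (subᶜ s A)

oneᶜ : ∀ {Θ σ} → Con Θ σ → Subᶜ (σ ∷ Θ) Θ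
oneᶜ U (here refl) = U
oneᶜ U (there x)   = tvar x

infix 9 _[_]ᶜ

_[_]ᶜ : ∀ {Θ σ τ} → Con (σ ∷ Θ) τ → Con Θ σ → Con Θ τ
T [ U ]ᶜ = subᶜ (oneᶜ U) T

infix 4 _≅_

-- There is deliberately no closure under ↓, ↑, ! and ⁇.
data _≅_ {Θ : KCtx} : ∀ {τ} → Con Θ τ → Con Θ τ → Set where
  ≅-refl  : ∀ {τ} {T : Con Θ τ} → T ≅ T
  ≅-sym   : ∀ {τ} {T U : Con Θ τ} → T ≅ U → U ≅ T
  ≅-trans : ∀ {τ} {T U V : Con Θ τ} → T ≅ U → U ≅ V → T ≅ V
  ≅-β     : ∀ {σ τ} {T : Con (σ ∷ Θ) τ} {U : Con Θ σ} → lam T · U ≅ T [ U ]ᶜ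
  ≅-η     : ∀ {σ τ} {T : Con Θ (σ ⇒ τ)} → lam (wkᶜ T · tvar (here refl)) ≅ T
  ≅-rec𝟎  : ∀ {τ} {T : Con Θ τ} {U : Con Θ (ι ⇒ τ ⇒ τ)} →
            rec τ · T · U · 𝟎 ≅ T
  ≅-rec𝐬  : ∀ {τ} {T : Con Θ τ} {U : Con Θ (ι ⇒ τ ⇒ τ)} {n : Con Θ ι} →
            rec τ · T · U · (𝐬 · n) ≅ U · n · (rec τ · T · U · n)
  ≅-rec⊥𝟎 : ∀ {τ} {T : Con Θ τ} {U : Con Θ (ι ⇒ τ ⇒ τ)} →
            rec⊥ τ · T · U · 𝟎 ≅ T ⊥ᶜ
  ≅-rec⊥𝐬 : ∀ {τ} {T : Con Θ τ} {U : Con Θ (ι ⇒ τ ⇒ τ)} {n : Con Θ ι} →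
            rec⊥ τ · T · U · (𝐬 · n) ≅ U ⊥ᶜ · n · (rec τ · T · U · n)
  ≅-lam   : ∀ {σ τ} {T T′ : Con (σ ∷ Θ) τ} → T ≅ T′ → lam T ≅ lam T′
  ≅-app   : ∀ {σ τ} {T T′ : Con Θ (σ ⇒ τ)} {U U′ : Con Θ σ} →
            T ≅ T′ → U ≅ U′ → T · U ≅ T′ · U′
  ≅-⊗     : ∀ {p q} {A A′ : Form Θ p} {B B′ : Form Θ q} →
            A ≅ A′ → B ≅ B′ → A ⊗ B ≅ A′ ⊗ B′
  ≅-⅋     : ∀ {p q} {A A′ : Form Θ p} {B B′ : Form Θ q} →
            A ≅ A′ → B ≅ B′ → A ⅋ B ≅ A′ ⅋ B′
  ≅-∃     : ∀ {τ p} {A A′ : Form (τ ∷ Θ) p} → A ≅ A′ → ∃̇ τ A ≅ ∃̇ τ A′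
  ≅-∀     : ∀ {τ p} {A A′ : Form (τ ∷ Θ) p} → A ≅ A′ → ∀̇ τ A ≅ ∀̇ τ A′

-- The polarities of the term variables in scope (de Bruijn).
Scope : Set
Scope = List Polarity

-- A finite set of declarations on variables of S: each variable is either
-- undeclared (nothing) or declared with a formula of the opposite polarity.
Ctx : KCtx → Scope → Set
Ctx Θ S = All (λ q → Maybe (Form Θ (opp q))) S

∅ : ∀ {Θ S} → Ctx Θ S
∅ {S = S} = All.universal (λ _ → nothing) S

wkCtx : ∀ {Θ S τ} → Ctx Θ S → Ctx (τ ∷ Θ) S
wkCtx = All.map (Maybe.map wkᶜ)

infix 4 _⊎_≋_

-- Ξ is the union of Γ and Δ, which are disjoint.
data _⊎_≋_ {Θ : KCtx} : ∀ {S} → Ctx Θ S → Ctx Θ S → Ctx Θ S → Set where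
  []    : [] ⊎ [] ≋ []
  none  : ∀ {q S} {Γ Δ Ξ : Ctx Θ S} → Γ ⊎ Δ ≋ Ξ →
          _⊎_≋_ {S = q ∷ S} (nothing ∷ Γ) (nothing ∷ Δ) (nothing ∷ Ξ)
  left  : ∀ {q S} {A : Form Θ (opp q)} {Γ Δ Ξ : Ctx Θ S} → Γ ⊎ Δ ≋ Ξ →
          _⊎_≋_ {S = q ∷ S} (just A ∷ Γ) (nothing ∷ Δ) (just A ∷ Ξ)
  right : ∀ {q S} {A : Form Θ (opp q)} {Γ Δ Ξ : Ctx Θ S} → Γ ⊎ Δ ≋ Ξ →
          _⊎_≋_ {S = q ∷ S} (nothing ∷ Γ) (just A ∷ Δ) (just A ∷ Ξ)

-- κ₁:A, …, κₙ:A, Γ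
copies : ∀ {Θ S} n {q} → Form Θ (opp q) → Ctx Θ S → Ctx Θ (replicate n q ++ S)
copies zero    A Γ = Γ
copies (suc n) A Γ = just A ∷ copies n A Γ

-- x₁:N₁, …, xₖ:Nₖ, provided that the xᵢ are distinct.
decls : ∀ {Θ S} → List (pos ∈ S × Form Θ neg) → Ctx Θ S
decls []             = ∅
decls ((x , N) ∷ ds) = decls ds [ x ]≔ just N

-- [κ/κ₁, …, κ/κₙ], where κ is the variable bound last in the target.
merge : ∀ {S : Scope} n {q} → (replicate n q ++ S) ⊆ (q ∷ S)
merge zero    x           = there x
merge (suc n) (here refl) = here refl
merge (suc n) (there x)   = merge n x

-- Turns the free variable x into one to be bound: x is sent to here refl,
-- any other y to there y.
capture : ∀ {S : Scope} {q} → q ∈ S → S ⊆ (q ∷ S)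
capture (here refl) (here refl) = here refl
capture (here refl) (there y)   = there (there y)
capture (there x)   (here refl) = there (here refl)
capture (there x)   (there y) with capture x y
... | here eq = here eq
... | there z = there (there z)

-- K pos and K neg are the constants k₊ and k₋; they have no typing rule.
module Calculus (K : Polarity → Set) where

  -- Val S pos: the V₊;  Val S neg: the t₋;  Tm S pos: the t₊.
  -- Every term of Tm S neg is a val, since negative terms are values.
  data Val (S : Scope) : Polarity → Set
  data Tm  (S : Scope) : Polarity → Set
  data Cmd (S : Scope) : Set

  data Val S where
    var   : ∀ {p} → p ∈ S → Val S p
    const : ∀ {p} → K p → Val S p
    pair  : ∀ {p q} → Val S p → Val S q → Val S pos         -- (V,V′)
    brace : ∀ {p} → Val S p → Val S pos                     -- {V}
    bang  : ∀ {p} → Val S p → Val S pos                     -- !V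
    μpair : ∀ p q → Cmd (p ∷ q ∷ S) → Val S neg             -- μ(κ,κ′).c
    μbrace : ∀ p → Cmd (p ∷ S) → Val S neg                  -- μ{κ}.c
    μbang : ∀ p → Cmd (p ∷ S) → Val S neg                   -- μ!(κ).c
    μ₋    : Cmd (pos ∷ S) → Val S neg                       -- μx.c

  data Tm S where
    val : ∀ {p} → Val S p → Tm S p
    μ₊  : Cmd (neg ∷ S) → Tm S pos                          -- μα.c

  data Cmd S where
    ⟨_∥_⟩ : Tm S pos → Tm S neg → Cmd S

  -- ⟨t|u⟩ and ⟨u|t⟩ are the same command.
  ⟨_∣_⟩ : ∀ {S p} → Tm S p → Tm S (opp p) → Cmd S
  ⟨_∣_⟩ {p = pos} t u = ⟨ t ∥ u ⟩
  ⟨_∣_⟩ {p = neg} t u = ⟨ u ∥ t ⟩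

  -- Binding occurrences and punctuation are not counted; counting them
  -- would change the size by at most a constant factor.
  sizeVal : ∀ {S p} → Val S p → ℕ
  size    : ∀ {S p} → Tm S p → ℕ
  sizeCmd : ∀ {S} → Cmd S → ℕ

  sizeVal (var x)      = 1
  sizeVal (const k)    = 1
  sizeVal (pair V V′)  = suc (sizeVal V + sizeVal V′)
  sizeVal (brace V)    = suc (sizeVal V)
  sizeVal (bang V)     = suc (sizeVal V)
  sizeVal (μpair p q c) = suc (sizeCmd c)
  sizeVal (μbrace p c) = suc (sizeCmd c)
  sizeVal (μbang p c)  = suc (sizeCmd c)
  sizeVal (μ₋ c)       = suc (sizeCmd c)

  size (val V) = sizeVal V
  size (μ₊ c)  = suc (sizeCmd c)

  sizeCmd ⟨ t ∥ u ⟩ = suc (size t + size u)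

  renVal : ∀ {S S′ p} → S ⊆ S′ → Val S p → Val S′ p
  renTm  : ∀ {S S′ p} → S ⊆ S′ → Tm S p → Tm S′ p
  renCmd : ∀ {S S′} → S ⊆ S′ → Cmd S → Cmd S′

  renVal ρ (var x)       = var (ρ x)
  renVal ρ (const k)     = const k
  renVal ρ (pair V V′)   = pair (renVal ρ V) (renVal ρ V′)
  renVal ρ (brace V)     = brace (renVal ρ V)
  renVal ρ (bang V)      = bang (renVal ρ V)
  renVal ρ (μpair p q c) = μpair p q (renCmd (liftRen (liftRen ρ)) c)
  renVal ρ (μbrace p c)  = μbrace p (renCmd (liftRen ρ) c)
  renVal ρ (μbang p c)   = μbang p (renCmd (liftRen ρ) c)
  renVal ρ (μ₋ c)        = μ₋ (renCmd (liftRen ρ) c)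

  renTm ρ (val V) = val (renVal ρ V)
  renTm ρ (μ₊ c)  = μ₊ (renCmd (liftRen ρ) c)

  renCmd ρ ⟨ t ∥ u ⟩ = ⟨ renTm ρ t ∥ renTm ρ u ⟩

  Sub : Scope → Scope → Set
  Sub S S′ = ∀ {p} → p ∈ S → Val S′ p

  liftSub : ∀ {S S′ q} → Sub S S′ → Sub (q ∷ S) (q ∷ S′)
  liftSub s (here refl) = var (here refl)
  liftSub s (there x)   = renVal there (s x)

  subVal : ∀ {S S′ p} → Sub S S′ → Val S p → Val S′ p
  subTm  : ∀ {S S′ p} → Sub S S′ → Tm S p → Tm S′ p
  subCmd : ∀ {S S′} → Sub S S′ → Cmd S → Cmd S′

  subVal s (var x)       = s x
  subVal s (const k)     = const k
  subVal s (pair V V′)   = pair (subVal s V) (subVal s V′)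
  subVal s (brace V)     = brace (subVal s V)
  subVal s (bang V)      = bang (subVal s V)
  subVal s (μpair p q c) = μpair p q (subCmd (liftSub (liftSub s)) c)
  subVal s (μbrace p c)  = μbrace p (subCmd (liftSub s) c)
  subVal s (μbang p c)   = μbang p (subCmd (liftSub s) c)
  subVal s (μ₋ c)        = μ₋ (subCmd (liftSub s) c)

  subTm s (val V) = val (subVal s V)
  subTm s (μ₊ c)  = μ₊ (subCmd (liftSub s) c)

  subCmd s ⟨ t ∥ u ⟩ = ⟨ subTm s t ∥ subTm s u ⟩

  infixr 5 _∷ˢ_

  _∷ˢ_ : ∀ {S S′ q} → Val S′ q → Sub S S′ → Sub (q ∷ S) S′
  (V ∷ˢ s) (here refl) = V
  (V ∷ˢ s) (there x)   = s x

  infix 9 _[_] _[_⨾_]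

  _[_] : ∀ {S p} → Cmd (p ∷ S) → Val S p → Cmd S
  c [ V ] = subCmd (V ∷ˢ var) c

  _[_⨾_] : ∀ {S p q} → Cmd (p ∷ q ∷ S) → Val S p → Val S q → Cmd S
  c [ V ⨾ V′ ] = subCmd (V ∷ˢ V′ ∷ˢ var) c

  -- !^α_{x₁,…,xₖ} V, for the enumeration x₁,…,xₖ of the index set.
  bangCmd : ∀ {S p} → List (pos ∈ S) → Val S p → neg ∈ S → Cmd S
  bangCmd []       V α = ⟨ val (bang V) ∥ val (var α) ⟩
  bangCmd (x ∷ xs) V α =
    ⟨ val (var x) ∥ val (μbang pos (renCmd (capture x) (bangCmd xs V α))) ⟩

  -- !_{x₁,…,xₖ} V
  bangTm : ∀ {S p} → List (pos ∈ S) → Val S p → Tm S pos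
  bangTm xs V = μ₊ (bangCmd (map there xs) (renVal there V) (here refl))

  infix 4 _⟶_ _⟶[_]_

  data _⟶_ {S : Scope} : Cmd S → Cmd S → Set where
    red-μ₊ : ∀ {c V} → ⟨ μ₊ c ∥ val V ⟩ ⟶ c [ V ]
    red-μ₋ : ∀ {V c} → ⟨ val V ∥ val (μ₋ c) ⟩ ⟶ c [ V ]
    red-brace : ∀ {p c} {V : Val S p} →
      ⟨ val (brace V) ∥ val (μbrace p c) ⟩ ⟶ c [ V ]
    red-pair : ∀ {p q c} {V : Val S p} {V′ : Val S q} →
      ⟨ val (pair V V′) ∥ val (μpair p q c) ⟩ ⟶ c [ V ⨾ V′ ]
    red-bang : ∀ {p c} {V : Val S p} →
      ⟨ val (bang V) ∥ val (μbang p c) ⟩ ⟶ c [ V ]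

  data _⟶[_]_ {S : Scope} : Cmd S → ℕ → Cmd S → Set where
    done : ∀ {c} → c ⟶[ 0 ] c
    step : ∀ {c c′ c″ n} → c ⟶ c′ → c′ ⟶[ n ] c″ → c ⟶[ suc n ] c″

  -- Reduction is deterministic, so there is a single maximal sequence.
  CmdNormalizesWithin : ∀ {S} → ℕ → Cmd S → Set
  CmdNormalizesWithin m c = ∃[ n ] ∃[ c′ ] n ≤ m × c ⟶[ n ] c′ × IsNormalForm _⟶_ c′

  NormalizesWithin : ∀ {S p} → ℕ → Tm S p → Set
  NormalizesWithin m t =
    CmdNormalizesWithin m ⟨ renTm there t ∣ val (var (here refl)) ⟩

  infix 3 ⊢_∶_∣_ _∶⊢_

  data ⊢_∶_∣_ {Θ : KCtx} {S : Scope} : ∀ {p} → Tm S p → Form Θ p → Ctx Θ S → Set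
  data _∶⊢_ {Θ : KCtx} {S : Scope} : Cmd S → Ctx Θ S → Set

  data ⊢_∶_∣_ {Θ} {S} where
    ax : ∀ {p} (x : p ∈ S) (A : Form Θ p) →
      ⊢ val (var x) ∶ A ∣ ∅ [ x ]≔ just (A ⊥ᶜ)
    ty-μ₊ : ∀ {c} {P : Form Θ pos} {Γ} →
      c ∶⊢ just P ∷ Γ →
      ⊢ μ₊ c ∶ P ∣ Γ
    ty-μ₋ : ∀ {c} {N : Form Θ neg} {Γ} →
      c ∶⊢ just N ∷ Γ →
      ⊢ val (μ₋ c) ∶ N ∣ Γ
    ty-⊗ : ∀ {p q} {V : Val S p} {V′ : Val S q} {A B Γ Δ Ξ} →
      ⊢ val V ∶ A ∣ Γ → ⊢ val V′ ∶ B ∣ Δ → Γ ⊎ Δ ≋ Ξ →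
      ⊢ val (pair V V′) ∶ A ⊗ B ∣ Ξ
    ty-⅋ : ∀ {p q c} {A : Form Θ (opp p)} {B : Form Θ (opp q)} {Γ} →
      c ∶⊢ just A ∷ just B ∷ Γ →
      ⊢ val (μpair p q c) ∶ A ⅋ B ∣ Γ
    ty-↓ : ∀ {p} {V : Val S p} {A Γ} →
      ⊢ val V ∶ A ∣ Γ →
      ⊢ val (brace V) ∶ ↓ A ∣ Γ
    ty-↑ : ∀ {p c} {A : Form Θ (opp p)} {Γ} →
      c ∶⊢ just A ∷ Γ →
      ⊢ val (μbrace p c) ∶ ↑ A ∣ Γ
    ty-∃ : ∀ {p τ} {t : Tm S p} {A : Form (τ ∷ Θ) p} {Γ} (T : Con Θ τ) →
      ⊢ t ∶ A [ T ]ᶜ ∣ Γ →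
      ⊢ t ∶ ∃̇ τ A ∣ Γ
    ty-∀ : ∀ {p τ} {V : Val S p} {A : Form (τ ∷ Θ) p} {Γ} →
      ⊢ val V ∶ A ∣ wkCtx Γ →
      ⊢ val V ∶ ∀̇ τ A ∣ Γ
    ty-! : ∀ {p} {V : Val S p} {A} (ds : List (pos ∈ S × Form Θ neg)) →
      Unique (map proj₁ ds) →
      ⊢ val V ∶ A ∣ decls ds →
      ⊢ bangTm (map proj₁ ds) V ∶ ! A ∣ decls (map (map₂ ⁇) ds)
    ty-M : ∀ n {q} {c : Cmd (replicate n q ++ S)} {A : Form Θ (opp q)} {Γ} →
      c ∶⊢ copies n A Γ →
      ⊢ val (μbang q (renCmd (merge n) c)) ∶ ⁇ A ∣ Γ

  data _∶⊢_ {Θ} {S} where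
    cut : ∀ {p} {t : Tm S p} {u : Tm S (opp p)} {A : Form Θ p} {Γ Δ Ξ} →
      ⊢ t ∶ A ∣ Γ → ⊢ u ∶ A ⊥ᶜ ∣ Δ → Γ ⊎ Δ ≋ Ξ →
      ⟨ t ∣ u ⟩ ∶⊢ Ξ
    conv : ∀ {c q Γ} (κ : q ∈ S) {A B : Form Θ (opp q)} →
      A ≅ B →
      c ∶⊢ Γ [ κ ]≔ just A →
      c ∶⊢ Γ [ κ ]≔ just B
    weak : ∀ {c q Γ} (κ : q ∈ S) (A : Form Θ (opp q)) →
      All.lookup Γ κ ≡ nothing →
      c ∶⊢ Γ →
      c ∶⊢ Γ [ κ ]≔ just A

  -- The maximal number of nested ty-! rules.
  δ    : ∀ {Θ S p} {t : Tm S p} {A : Form Θ p} {Γ} → ⊢ t ∶ A ∣ Γ → ℕ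
  δCmd : ∀ {Θ S} {c : Cmd S} {Γ : Ctx Θ S} → c ∶⊢ Γ → ℕ

  δ (ax x A)      = 0
  δ (ty-μ₊ π)     = δCmd π
  δ (ty-μ₋ π)     = δCmd π
  δ (ty-⊗ π π′ _) = δ π ⊔ δ π′
  δ (ty-⅋ π)      = δCmd π
  δ (ty-↓ π)      = δ π
  δ (ty-↑ π)      = δCmd π
  δ (ty-∃ T π)    = δ π
  δ (ty-∀ π)      = δ π
  δ (ty-! ds _ π) = suc (δ π)
  δ (ty-M n π)    = δCmd π

  δCmd (cut π π′ _)   = δ π ⊔ δ π′
  δCmd (conv κ _ π)   = δCmd π
  δCmd (weak κ A _ π) = δCmd π

{-# OPTIONS --safe #-}

-- Fix N and weigh a command by its number of symbols, where the contents of
-- each !V count N times and variables count 0. Call a command soft if every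
-- variable bound by μ! has at most N occurrences, weighted by N to the power
-- of their depth, and every other bound variable at most one. Softness does
-- not mention formulas, is preserved by substitution of soft values, and makes
-- each reduction decrease the weight: in ⟨μ!(κ).c|!V⟩ → c[V/κ] the N copies of
-- V are paid for by the !. A derivation makes its term soft for N = |t|, since
-- the variables merged by M_n occur at depth 0 and hence at most |t| times,
-- whereas a variable bound in !_S V occurs once, at depth 1. The weight is then
-- at most |t| · N ^ δ(π).

module Submission where

open import Defs
import Algebra.Properties.CommutativeSemigroup as CommSemigroup
open import Data.List.Base using (List; []; _∷_; _++_; replicate; map; length)
open import Data.List.Membership.Propositional using (_∈_; _∉_)
open import Data.List.Properties using (map-∘; length-map)
open import Data.List.Relation.Binary.Subset.Propositional using (_⊆_)
open import Data.List.Relation.Unary.All as All using (All; []; _∷_; _[_]≔_)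
open import Data.List.Relation.Unary.All.Properties using (All¬⇒¬Any; lookup∘updateAt′)
open import Data.List.Relation.Unary.Any using (here; there)
open import Data.List.Relation.Unary.Any.Properties using (there-injective)
open import Data.List.Relation.Unary.Unique.Propositional using (Unique; []; _∷_)
open import Data.List.Relation.Unary.Unique.Propositional.Properties using () renaming (map⁺ to Unique-map⁺)
open import Data.Maybe.Base using (just; nothing)
open import Data.Nat.Base using (ℕ; zero; suc; _+_; _*_; _^_; _⊔_; _≤_; _<_; z≤n; s≤s; s≤s⁻¹; NonZero; >-nonZero)
open import Data.Nat.ListAction using (sum)
open import Data.Nat.Properties hiding (_≟_)
open import Data.Product.Base using (Σ-syntax; ∃-syntax; _×_; _,_; proj₁; map₂)
open import Data.Sign.Base using () renaming (Sign to Polarity; + to pos; - to neg; opposite to opp)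
open import Data.Sign.Properties using (_≟_)
open import Data.Sum.Base using (_⊎_; inj₁; inj₂)
open import Data.Unit.Base using (⊤; tt)
open import Function.Base using (_∘_)
open import Relation.Binary.PropositionalEquality hiding ([_])
open import Relation.Binary.Rewriting using (IsNormalForm)
open import Relation.Nullary.Decidable.Core using (yes; no)
open import Relation.Nullary.Negation.Core using (contradiction)

-- Assignments of weights to variables

Env : Scope → Set
Env S = ∀ {p} → p ∈ S → ℕ

𝟘 : ∀ {S} → Env S
𝟘 _ = 0

infixr 5 _◂_

_◂_ : ∀ {S q} → ℕ → Env S → Env (q ∷ S)
(a ◂ ρ) (here refl) = a
(a ◂ ρ) (there x)   = ρ x

◂-mono : ∀ {S q a} {ρ ρ′ : Env S} → (∀ {p} (x : p ∈ S) → ρ x ≤ ρ′ x) →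
         ∀ {p} (x : p ∈ q ∷ S) → (a ◂ ρ) x ≤ (a ◂ ρ′) x
◂-mono ρ≤ρ′ (here refl) = ≤-refl
◂-mono ρ≤ρ′ (there x)   = ρ≤ρ′ x

◂-cong : ∀ {S q a} {ρ ρ′ : Env S} → (∀ {p} (x : p ∈ S) → ρ x ≡ ρ′ x) →
         ∀ {p} (x : p ∈ q ∷ S) → (a ◂ ρ) x ≡ (a ◂ ρ′) x
◂-cong ρ≡ρ′ (here refl) = refl
◂-cong ρ≡ρ′ (there x)   = ρ≡ρ′ x

◂-bound : ∀ {S q a b} {ρ : Env S} → b ≤ a → (∀ {p} (x : p ∈ S) → ρ x ≤ a) →
          ∀ {p} (x : p ∈ q ∷ S) → (b ◂ ρ) x ≤ a
◂-bound b≤a ρ≤a (here refl) = b≤a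
◂-bound b≤a ρ≤a (there x)   = ρ≤a x

◂-𝟘 : ∀ {S q p} (x : p ∈ q ∷ S) → (0 ◂ 𝟘 {S}) x ≡ 0
◂-𝟘 (here refl) = refl
◂-𝟘 (there x)   = refl

◂-zero : ∀ {S q} {ρ : Env S} → (∀ {p} (x : p ∈ S) → ρ x ≡ 0) →
         ∀ {p} (x : p ∈ q ∷ S) → (0 ◂ ρ) x ≡ 0
◂-zero ρ≡0 (here refl) = refl
◂-zero ρ≡0 (there x)   = ρ≡0 x

◂-liftRen : ∀ {S S′ q a} {ρ : Env S′} (r : S ⊆ S′) {p} (x : p ∈ q ∷ S) →
            (a ◂ ρ) (liftRen r x) ≡ (a ◂ (λ y → ρ (r y))) x
◂-liftRen r (here refl) = refl
◂-liftRen r (there x)   = refl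

open CommSemigroup +-commutativeSemigroup using (interchange; x∙yz≈y∙xz)
open CommSemigroup *-commutativeSemigroup using () renaming (x∙yz≈y∙xz to x*yz≡y*xz)

-- Capturing a variable

-- The graph of `capture x`, used as a view: matching on `captured x y` evaluates `capture x y`
-- without a case analysis of de Bruijn indices.
data Captured {S : Scope} {q} (x : q ∈ S) : ∀ {r} → r ∈ S → r ∈ q ∷ S → Set where
  same  : Captured x x (here refl)
  other : ∀ {r} {y : r ∈ S} → Captured x y (there y)

captured : ∀ {S : Scope} {q r} (x : q ∈ S) (y : r ∈ S) → Captured x y (capture x y)
captured (here refl) (here refl) = same
captured (here refl) (there y)   = other
captured (there x)   (here refl) = other
captured (there x)   (there y) with capture x y | captured x y
... | .(here refl) | same  = same
... | .(there y)   | other = other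

capture-self : ∀ {S : Scope} {q} (x : q ∈ S) → capture x x ≡ here refl
capture-self (here refl) = refl
capture-self (there x) rewrite capture-self x = refl

sumAt : ∀ {S} → Env S → List (pos ∈ S) → ℕ
sumAt ρ xs = sum (map ρ xs)

sumAt-mono : ∀ {S} {ρ ρ′ : Env S} → (∀ {p} (x : p ∈ S) → ρ x ≤ ρ′ x) →
             ∀ xs → sumAt ρ xs ≤ sumAt ρ′ xs
sumAt-mono h []       = z≤n
sumAt-mono {ρ = ρ} {ρ′} h (x ∷ xs) = +-mono-≤ (h x) (sumAt-mono {ρ = ρ} {ρ′} h xs)

sumAt-zero : ∀ {S} {ρ : Env S} xs → (∀ {x} → x ∈ xs → ρ x ≡ 0) → sumAt ρ xs ≡ 0
sumAt-zero []       h = refl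
sumAt-zero {ρ = ρ} (x ∷ xs) h = cong₂ _+_ (h (here refl)) (sumAt-zero {ρ = ρ} xs (h ∘ there))

sumAt-bound : ∀ {S a} {ρ : Env S} → (∀ {p} (x : p ∈ S) → ρ x ≤ a) →
              ∀ xs → sumAt ρ xs ≤ length xs * a
sumAt-bound h []       = z≤n
sumAt-bound {ρ = ρ} h (x ∷ xs) = +-mono-≤ (h x) (sumAt-bound {ρ = ρ} h xs)

sumAt-there : ∀ {S q} (ρ : Env (q ∷ S)) xs → sumAt ρ (map there xs) ≡ sumAt (λ x → ρ (there x)) xs
sumAt-there ρ xs = cong sum (sym (map-∘ xs))

sumAt-capture-∉ : ∀ {S a} {x : pos ∈ S} {xs} → x ∉ xs → sumAt (λ y → (a ◂ 𝟘) (capture x y)) xs ≡ 0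
sumAt-capture-∉ {a = a} {x} {xs} x∉xs = sumAt-zero {ρ = zeroed} xs zero-at
  where
  zeroed : Env _
  zeroed y = (a ◂ 𝟘) (capture x y)

  zero-at : ∀ {y} → y ∈ xs → (a ◂ 𝟘) (capture x y) ≡ 0
  zero-at {y} y∈xs with capture x y | captured x y
  ... | .(here refl) | same  = contradiction y∈xs x∉xs
  ... | .(there y)   | other = refl

-- Only `x` itself is sent to the variable of weight `a`, and a list without repetitions contains it
-- at most once.
sumAt-capture : ∀ {S q a} {x : q ∈ S} {xs} → Unique xs → sumAt (λ y → (a ◂ 𝟘) (capture x y)) xs ≤ a
sumAt-capture [] = z≤n
sumAt-capture {a = a} {x} {y ∷ xs} (y∉ ∷ u) with capture x y | captured x y
... | .(here refl) | same  =
  ≤-reflexive (trans (cong (a +_) (sumAt-capture-∉ (All¬⇒¬Any y∉))) (+-identityʳ a))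
... | .(there y)   | other = sumAt-capture {x = x} u

-- This form is what `wtCmd-ren` produces for a body renamed by `capture x` under a binder: the
-- captured variable has become bound and weighs 0, the others keep their weight.
zeroAt : ∀ {S q} → q ∈ S → Env S → Env S
zeroAt x ρ y = (0 ◂ ρ) (capture x y)

zeroAt-≤ : ∀ {S q} (x : q ∈ S) (ρ : Env S) {r} (y : r ∈ S) → zeroAt x ρ y ≤ ρ y
zeroAt-≤ x ρ y with capture x y | captured x y
... | .(here refl) | same  = z≤n
... | .(there y)   | other = ≤-refl

zeroAll : ∀ {S} → List (pos ∈ S) → Env S → Env S
zeroAll []       ρ = ρ
zeroAll (x ∷ xs) ρ = zeroAll xs (zeroAt x ρ)

zeroAll-≤ : ∀ {S} xs (ρ : Env S) {r} (y : r ∈ S) → zeroAll xs ρ y ≤ ρ y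
zeroAll-≤ []       ρ y = ≤-refl
zeroAll-≤ (x ∷ xs) ρ y = ≤-trans (zeroAll-≤ xs (zeroAt x ρ) y) (zeroAt-≤ x ρ y)

zeroAll-∈ : ∀ {S} xs (ρ : Env S) {x} → x ∈ xs → zeroAll xs ρ x ≡ 0
zeroAll-∈ (x ∷ xs) ρ (here refl) = n≤0⇒n≡0 (≤-trans (zeroAll-≤ xs (zeroAt x ρ) x)
  (≤-reflexive (cong (0 ◂ ρ) (capture-self x))))
zeroAll-∈ (x ∷ xs) ρ (there x∈)  = zeroAll-∈ xs (zeroAt x ρ) x∈

-- Total weight of the declared variables

total : ∀ {Θ S} → Ctx Θ S → Env S → ℕ
total []            ρ = 0
total (nothing ∷ Γ) ρ = total Γ (λ x → ρ (there x))
total (just A ∷ Γ)  ρ = ρ (here refl) + total Γ (λ x → ρ (there x))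

total-𝟘 : ∀ {Θ S} (Γ : Ctx Θ S) → total Γ 𝟘 ≡ 0
total-𝟘 []            = refl
total-𝟘 (nothing ∷ Γ) = total-𝟘 Γ
total-𝟘 (just A ∷ Γ)  = total-𝟘 Γ

total-∅ : ∀ {Θ} S (ρ : Env S) → total (∅ {Θ}) ρ ≡ 0
total-∅ []      ρ = refl
total-∅ (q ∷ S) ρ = total-∅ S (λ x → ρ (there x))

lookup-∅ : ∀ {Θ S q} (x : q ∈ S) → All.lookup (∅ {Θ}) x ≡ nothing
lookup-∅ (here refl) = refl
lookup-∅ (there x)   = lookup-∅ x

total-wk : ∀ {Θ S τ} (Γ : Ctx Θ S) (ρ : Env S) → total (wkCtx {τ = τ} Γ) ρ ≡ total Γ ρ
total-wk []            ρ = refl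
total-wk (nothing ∷ Γ) ρ = total-wk Γ _
total-wk (just A ∷ Γ)  ρ = cong (_ +_) (total-wk Γ _)

total-⊎ : ∀ {Θ S} {Γ Δ Ξ : Ctx Θ S} → Γ ⊎ Δ ≋ Ξ → (ρ : Env S) → total Γ ρ + total Δ ρ ≡ total Ξ ρ
total-⊎ []        ρ = refl
total-⊎ (none s)  ρ = total-⊎ s _
total-⊎ (left {Γ = Γ} s)  ρ = trans (+-assoc (ρ (here refl)) (total Γ _) _) (cong (ρ (here refl) +_) (total-⊎ s _))
total-⊎ (right {Γ = Γ} s) ρ =
  trans (x∙yz≈y∙xz (total Γ _) (ρ (here refl)) _) (cong (ρ (here refl) +_) (total-⊎ s _))

total-≔ : ∀ {Θ S q A} (Γ : Ctx Θ S) (x : q ∈ S) (ρ : Env S) → All.lookup Γ x ≡ nothing →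
          total (Γ [ x ]≔ just A) ρ ≡ ρ x + total Γ ρ
total-≔ (.nothing ∷ Γ) (here refl) ρ refl = refl
total-≔ (nothing ∷ Γ)  (there x)   ρ eq   = total-≔ Γ x _ eq
total-≔ (just A ∷ Γ)   (there x)   ρ eq   =
  trans (cong (ρ (here refl) +_) (total-≔ Γ x _ eq)) (x∙yz≈y∙xz (ρ (here refl)) (ρ (there x)) _)

-- If `x` is already declared in `Γ`, the update replaces that declaration and the total stays the
-- same; hence only an inequality.
total-≔-≤ : ∀ {Θ S q A} (Γ : Ctx Θ S) (x : q ∈ S) (ρ : Env S) →
            total (Γ [ x ]≔ just A) ρ ≤ ρ x + total Γ ρ
total-≔-≤ (nothing ∷ Γ) (here refl) ρ = ≤-refl
total-≔-≤ (just A ∷ Γ)  (here refl) ρ = +-monoʳ-≤ (ρ (here refl)) (m≤n+m _ _)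
total-≔-≤ (nothing ∷ Γ) (there x)   ρ = total-≔-≤ Γ x _
total-≔-≤ (just A ∷ Γ)  (there x)   ρ =
  ≤-trans (+-monoʳ-≤ (ρ (here refl)) (total-≔-≤ Γ x _)) (≤-reflexive (x∙yz≈y∙xz (ρ (here refl)) (ρ (there x)) _))

total-≔-formula : ∀ {Θ S q A B} (Γ : Ctx Θ S) (x : q ∈ S) (ρ : Env S) →
                  total (Γ [ x ]≔ just A) ρ ≡ total (Γ [ x ]≔ just B) ρ
total-≔-formula (G ∷ Γ)       (here refl) ρ = refl
total-≔-formula (nothing ∷ Γ) (there x)   ρ = total-≔-formula Γ x _
total-≔-formula (just C ∷ Γ)  (there x)   ρ = cong (_ +_) (total-≔-formula Γ x _)

-- All `n` copies are merged into the bound variable, which weighs 0.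
total-copies : ∀ {Θ S} n {q} {A : Form Θ (opp q)} (Γ : Ctx Θ S) (ρ : Env S) →
               total (copies n A Γ) (λ x → (0 ◂ ρ) (merge n {q} x)) ≡ total Γ ρ
total-copies zero    Γ ρ = refl
total-copies (suc n) Γ ρ = total-copies n Γ ρ

total-decls-≤ : ∀ {Θ S} (ds : List (pos ∈ S × Form Θ neg)) (ρ : Env S) →
                total (decls ds) ρ ≤ sumAt ρ (map proj₁ ds)
total-decls-≤ {S = S} []       ρ = ≤-reflexive (total-∅ S ρ)
total-decls-≤ ((x , N) ∷ ds)   ρ =
  ≤-trans (total-≔-≤ (decls ds) x ρ) (+-monoʳ-≤ (ρ x) (total-decls-≤ ds ρ))

lookup-decls : ∀ {Θ S} {x : pos ∈ S} (ds : List (pos ∈ S × Form Θ neg)) → All (x ≢_) (map proj₁ ds) →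
               All.lookup (decls ds) x ≡ nothing
lookup-decls {x = x} [] _ = lookup-∅ x
lookup-decls {x = x} ((y , N) ∷ ds) (x≢y ∷ x∉) =
  trans (lookup∘updateAt′ x y {f = λ _ → just N} {px = nothing} (decls ds) λ { refl → x≢y }) (lookup-decls ds x∉)

-- Distinctness rules out that a later declaration overwrites an earlier one, so every variable
-- contributes its own summand.
total-decls : ∀ {Θ S} (ds : List (pos ∈ S × Form Θ neg)) (ρ : Env S) → Unique (map proj₁ ds) →
              total (decls ds) ρ ≡ sumAt ρ (map proj₁ ds)
total-decls {S = S} []     ρ _        = total-∅ S ρ
total-decls ((x , N) ∷ ds) ρ (x∉ ∷ u) =
  trans (total-≔ (decls ds) x ρ (lookup-decls ds x∉)) (cong (ρ x +_) (total-decls ds ρ u))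

-- Weights of terms, and how substitution acts on them

module Weight (K : Polarity → Set) (N : ℕ) where
  open Calculus K

  -- Each symbol other than a variable costs e. With e = 0 this is the number of
  -- occurrences of variables, weighted by ρ and by N to the power of the depth.
  wtVal : ∀ {S p} → ℕ → Env S → Val S p → ℕ
  wtTm  : ∀ {S p} → ℕ → Env S → Tm S p → ℕ
  wtCmd : ∀ {S} → ℕ → Env S → Cmd S → ℕ

  wtVal e ρ (var x)       = ρ x
  wtVal e ρ (const k)     = e
  wtVal e ρ (pair V V′)   = e + (wtVal e ρ V + wtVal e ρ V′)
  wtVal e ρ (brace V)     = e + wtVal e ρ V
  wtVal e ρ (bang V)      = e + N * wtVal e ρ V
  wtVal e ρ (μpair p q c) = e + wtCmd e (0 ◂ 0 ◂ ρ) c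
  wtVal e ρ (μbrace p c)  = e + wtCmd e (0 ◂ ρ) c
  wtVal e ρ (μbang p c)   = e + wtCmd e (0 ◂ ρ) c
  wtVal e ρ (μ₋ c)        = e + wtCmd e (0 ◂ ρ) c

  wtTm e ρ (val V) = wtVal e ρ V
  wtTm e ρ (μ₊ c)  = e + wtCmd e (0 ◂ ρ) c

  wtCmd e ρ ⟨ t ∥ u ⟩ = e + (wtTm e ρ t + wtTm e ρ u)

  module _ {e : ℕ} where

    wtVal-mono : ∀ {S p} {ρ ρ′ : Env S} → (∀ {q} (x : q ∈ S) → ρ x ≤ ρ′ x) →
                 (V : Val S p) → wtVal e ρ V ≤ wtVal e ρ′ V
    wtTm-mono  : ∀ {S p} {ρ ρ′ : Env S} → (∀ {q} (x : q ∈ S) → ρ x ≤ ρ′ x) →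
                 (t : Tm S p) → wtTm e ρ t ≤ wtTm e ρ′ t
    wtCmd-mono : ∀ {S} {ρ ρ′ : Env S} → (∀ {q} (x : q ∈ S) → ρ x ≤ ρ′ x) →
                 (c : Cmd S) → wtCmd e ρ c ≤ wtCmd e ρ′ c

    wtVal-mono h (var x)       = h x
    wtVal-mono h (const k)     = ≤-refl
    wtVal-mono h (pair V V′)   = +-monoʳ-≤ e (+-mono-≤ (wtVal-mono h V) (wtVal-mono h V′))
    wtVal-mono h (brace V)     = +-monoʳ-≤ e (wtVal-mono h V)
    wtVal-mono h (bang V)      = +-monoʳ-≤ e (*-monoʳ-≤ N (wtVal-mono h V))
    wtVal-mono h (μpair p q c) = +-monoʳ-≤ e (wtCmd-mono (◂-mono (◂-mono h)) c)
    wtVal-mono h (μbrace p c)  = +-monoʳ-≤ e (wtCmd-mono (◂-mono h) c)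
    wtVal-mono h (μbang p c)   = +-monoʳ-≤ e (wtCmd-mono (◂-mono h) c)
    wtVal-mono h (μ₋ c)        = +-monoʳ-≤ e (wtCmd-mono (◂-mono h) c)

    wtTm-mono h (val V) = wtVal-mono h V
    wtTm-mono h (μ₊ c)  = +-monoʳ-≤ e (wtCmd-mono (◂-mono h) c)

    wtCmd-mono h ⟨ t ∥ u ⟩ = +-monoʳ-≤ e (+-mono-≤ (wtTm-mono h t) (wtTm-mono h u))

    -- Takes the place of function extensionality on environments, for instance to identify `0 ◂ 𝟘`
    -- with `𝟘`.
    wtCmd-cong : ∀ {S} {ρ ρ′ : Env S} → (∀ {q} (x : q ∈ S) → ρ x ≡ ρ′ x) →
                 (c : Cmd S) → wtCmd e ρ c ≡ wtCmd e ρ′ c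
    wtCmd-cong h c = ≤-antisym (wtCmd-mono (≤-reflexive ∘ h) c) (wtCmd-mono (≤-reflexive ∘ sym ∘ h) c)

    wtVal-ren : ∀ {S S′ p} {ρ : Env S′} (r : S ⊆ S′) (V : Val S p) →
                wtVal e ρ (renVal r V) ≡ wtVal e (λ x → ρ (r x)) V
    wtTm-ren  : ∀ {S S′ p} {ρ : Env S′} (r : S ⊆ S′) (t : Tm S p) →
                wtTm e ρ (renTm r t) ≡ wtTm e (λ x → ρ (r x)) t
    wtCmd-ren : ∀ {S S′} {ρ : Env S′} (r : S ⊆ S′) (c : Cmd S) →
                wtCmd e ρ (renCmd r c) ≡ wtCmd e (λ x → ρ (r x)) c
    wtCmd-liftRen : ∀ {S S′ q a} {ρ : Env S′} (r : S ⊆ S′) (c : Cmd (q ∷ S)) →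
                wtCmd e (a ◂ ρ) (renCmd (liftRen r) c) ≡ wtCmd e (a ◂ (λ x → ρ (r x))) c
    wtCmd-liftRen₂ : ∀ {S S′ q q′ a b} {ρ : Env S′} (r : S ⊆ S′) (c : Cmd (q ∷ q′ ∷ S)) →
                wtCmd e (a ◂ b ◂ ρ) (renCmd (liftRen (liftRen r)) c) ≡ wtCmd e (a ◂ b ◂ (λ x → ρ (r x))) c

    wtVal-ren r (var x)       = refl
    wtVal-ren r (const k)     = refl
    wtVal-ren r (pair V V′)   = cong (e +_) (cong₂ _+_ (wtVal-ren r V) (wtVal-ren r V′))
    wtVal-ren r (brace V)     = cong (e +_) (wtVal-ren r V)
    wtVal-ren r (bang V)      = cong (λ w → e + N * w) (wtVal-ren r V)
    wtVal-ren r (μpair p q c) = cong (e +_) (wtCmd-liftRen₂ r c)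
    wtVal-ren r (μbrace p c)  = cong (e +_) (wtCmd-liftRen r c)
    wtVal-ren r (μbang p c)   = cong (e +_) (wtCmd-liftRen r c)
    wtVal-ren r (μ₋ c)        = cong (e +_) (wtCmd-liftRen r c)

    wtTm-ren r (val V) = wtVal-ren r V
    wtTm-ren r (μ₊ c)  = cong (e +_) (wtCmd-liftRen r c)

    wtCmd-ren r ⟨ t ∥ u ⟩ = cong (e +_) (cong₂ _+_ (wtTm-ren r t) (wtTm-ren r u))

    wtCmd-liftRen r c = trans (wtCmd-ren (liftRen r) c) (wtCmd-cong (◂-liftRen r) c)

    wtCmd-liftRen₂ r c =
      trans (wtCmd-liftRen (liftRen r) c) (wtCmd-cong (◂-cong (◂-liftRen r)) c)

    ◂-liftSub : ∀ {S S′ q a} {ρ : Env S′} (s : Sub S S′) {p} (x : p ∈ q ∷ S) →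
                wtVal e (a ◂ ρ) (liftSub s x) ≡ (a ◂ (λ y → wtVal e ρ (s y))) x
    ◂-liftSub s (here refl) = refl
    ◂-liftSub s (there x)   = wtVal-ren there (s x)

    -- The weight is compositional: an environment interprets variables by numbers, and a
    -- substitution interprets each variable by the weight of its image. Inside a `bang` both sides
    -- pick up the same factor `N`.
    wtVal-sub : ∀ {S S′ p} {ρ : Env S′} (s : Sub S S′) (V : Val S p) →
                wtVal e ρ (subVal s V) ≡ wtVal e (λ x → wtVal e ρ (s x)) V
    wtTm-sub  : ∀ {S S′ p} {ρ : Env S′} (s : Sub S S′) (t : Tm S p) →
                wtTm e ρ (subTm s t) ≡ wtTm e (λ x → wtVal e ρ (s x)) t
    wtCmd-sub : ∀ {S S′} {ρ : Env S′} (s : Sub S S′) (c : Cmd S) →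
                wtCmd e ρ (subCmd s c) ≡ wtCmd e (λ x → wtVal e ρ (s x)) c
    wtCmd-liftSub : ∀ {S S′ q a} {ρ : Env S′} (s : Sub S S′) (c : Cmd (q ∷ S)) →
                wtCmd e (a ◂ ρ) (subCmd (liftSub s) c) ≡ wtCmd e (a ◂ (λ x → wtVal e ρ (s x))) c
    wtCmd-liftSub₂ : ∀ {S S′ q q′ a b} {ρ : Env S′} (s : Sub S S′) (c : Cmd (q ∷ q′ ∷ S)) →
                wtCmd e (a ◂ b ◂ ρ) (subCmd (liftSub (liftSub s)) c)
                  ≡ wtCmd e (a ◂ b ◂ (λ x → wtVal e ρ (s x))) c

    wtVal-sub s (var x)       = refl
    wtVal-sub s (const k)     = refl
    wtVal-sub s (pair V V′)   = cong (e +_) (cong₂ _+_ (wtVal-sub s V) (wtVal-sub s V′))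
    wtVal-sub s (brace V)     = cong (e +_) (wtVal-sub s V)
    wtVal-sub s (bang V)      = cong (λ w → e + N * w) (wtVal-sub s V)
    wtVal-sub s (μpair p q c) = cong (e +_) (wtCmd-liftSub₂ s c)
    wtVal-sub s (μbrace p c)  = cong (e +_) (wtCmd-liftSub s c)
    wtVal-sub s (μbang p c)   = cong (e +_) (wtCmd-liftSub s c)
    wtVal-sub s (μ₋ c)        = cong (e +_) (wtCmd-liftSub s c)

    wtTm-sub s (val V) = wtVal-sub s V
    wtTm-sub s (μ₊ c)  = cong (e +_) (wtCmd-liftSub s c)

    wtCmd-sub s ⟨ t ∥ u ⟩ = cong (e +_) (cong₂ _+_ (wtTm-sub s t) (wtTm-sub s u))

    wtCmd-liftSub s c = trans (wtCmd-sub (liftSub s) c) (wtCmd-cong (◂-liftSub s) c)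

    wtCmd-liftSub₂ s c =
      trans (wtCmd-liftSub (liftSub s) c) (wtCmd-cong (◂-cong (◂-liftSub s)) c)

    -- The weight is an affine function of the environment: the symbols give the constant part, the
    -- occurrences of variables the linear part.
    wtVal-split : ∀ {S p} {ρ : Env S} (V : Val S p) → wtVal e ρ V ≡ wtVal e 𝟘 V + wtVal 0 ρ V
    wtTm-split  : ∀ {S p} {ρ : Env S} (t : Tm S p) → wtTm e ρ t ≡ wtTm e 𝟘 t + wtTm 0 ρ t
    wtCmd-split : ∀ {S} {ρ : Env S} (c : Cmd S) → wtCmd e ρ c ≡ wtCmd e 𝟘 c + wtCmd 0 ρ c
    wtBind-split : ∀ {S} {ρ ρ′ : Env S} → (∀ {q} (x : q ∈ S) → ρ′ x ≡ 0) → (c : Cmd S) →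
                   e + wtCmd e ρ c ≡ (e + wtCmd e ρ′ c) + wtCmd 0 ρ c

    wtVal-split (var x)     = refl
    wtVal-split (const k)   = sym (+-identityʳ e)
    wtVal-split {ρ = ρ} (pair V V′) =
      trans (cong (e +_) (trans (cong₂ _+_ (wtVal-split V) (wtVal-split V′))
                                (interchange (wtVal e 𝟘 V) (wtVal 0 ρ V) _ _)))
            (sym (+-assoc e _ _))
    wtVal-split (brace V)   = trans (cong (e +_) (wtVal-split V)) (sym (+-assoc e _ _))
    wtVal-split {ρ = ρ} (bang V) =
      trans (cong (e +_) (trans (cong (N *_) (wtVal-split V)) (*-distribˡ-+ N (wtVal e 𝟘 V) (wtVal 0 ρ V))))
            (sym (+-assoc e _ _))
    wtVal-split (μpair p q c) = wtBind-split (◂-zero ◂-𝟘) c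
    wtVal-split (μbrace p c)  = wtBind-split ◂-𝟘 c
    wtVal-split (μbang p c)   = wtBind-split ◂-𝟘 c
    wtVal-split (μ₋ c)        = wtBind-split ◂-𝟘 c

    wtTm-split (val V) = wtVal-split V
    wtTm-split (μ₊ c)  = wtBind-split ◂-𝟘 c

    wtCmd-split {ρ = ρ} ⟨ t ∥ u ⟩ =
      trans (cong (e +_) (trans (cong₂ _+_ (wtTm-split t) (wtTm-split u))
                                (interchange (wtTm e 𝟘 t) (wtTm 0 ρ t) _ _)))
            (sym (+-assoc e _ _))

    wtBind-split ρ′≡0 c =
      trans (cong (e +_) (trans (wtCmd-split c) (cong (_+ _) (sym (wtCmd-cong ρ′≡0 c)))))
            (sym (+-assoc e _ _))

  wtVal-𝟘 : ∀ {S p} (V : Val S p) → wtVal 0 𝟘 V ≡ 0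
  -- For `e = 0` and `ρ = 𝟘` the splitting reads `w ≡ w + w`, whence `w` is 0.
  wtVal-𝟘 V = sym (+-cancelˡ-≡ (wtVal 0 𝟘 V) _ _ (trans (+-identityʳ _) (wtVal-split V)))

  -- Soft terms and their closure under renaming and substitution

  -- With all other variables at 0, `wtCmd 0 (a ◂ 𝟘) c` is linear in `a`, so an inequality for all
  -- `a` bounds the weighted number of occurrences of the bound variable. In this form it applies
  -- directly with `a` the weight of a value about to be substituted.
  softVal : ∀ {S p} → Val S p → Set
  softTm  : ∀ {S p} → Tm S p → Set
  softCmd : ∀ {S} → Cmd S → Set

  softVal (var x)       = ⊤
  softVal (const k)     = ⊤
  softVal (pair V V′)   = softVal V × softVal V′
  softVal (brace V)     = softVal V
  softVal (bang V)      = softVal V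
  softVal (μpair p q c) = (∀ a b → wtCmd 0 (a ◂ b ◂ 𝟘) c ≤ a + b) × softCmd c
  softVal (μbrace p c)  = (∀ a → wtCmd 0 (a ◂ 𝟘) c ≤ a) × softCmd c
  softVal (μbang p c)   = (∀ a → wtCmd 0 (a ◂ 𝟘) c ≤ N * a) × softCmd c
  softVal (μ₋ c)        = (∀ a → wtCmd 0 (a ◂ 𝟘) c ≤ a) × softCmd c

  softTm (val V) = softVal V
  softTm (μ₊ c)  = (∀ a → wtCmd 0 (a ◂ 𝟘) c ≤ a) × softCmd c

  softCmd ⟨ t ∥ u ⟩ = softTm t × softTm u

  softVal-ren : ∀ {S S′ p} (r : S ⊆ S′) (V : Val S p) → softVal V → softVal (renVal r V)
  softTm-ren  : ∀ {S S′ p} (r : S ⊆ S′) (t : Tm S p) → softTm t → softTm (renTm r t)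
  softCmd-ren : ∀ {S S′} (r : S ⊆ S′) (c : Cmd S) → softCmd c → softCmd (renCmd r c)
  -- `f` is the identity for affine binders and multiplication by `N` for `μbang`.
  softBind-ren : ∀ {S S′ q} (r : S ⊆ S′) (c : Cmd (q ∷ S)) {f : ℕ → ℕ} →
    (∀ a → wtCmd 0 (a ◂ 𝟘) c ≤ f a) × softCmd c →
    (∀ a → wtCmd 0 (a ◂ 𝟘) (renCmd (liftRen r) c) ≤ f a) × softCmd (renCmd (liftRen r) c)

  softVal-ren r (var x)       _         = tt
  softVal-ren r (const k)     _         = tt
  softVal-ren r (pair V V′)   (sV , sV′) = softVal-ren r V sV , softVal-ren r V′ sV′
  softVal-ren r (brace V)     sV        = softVal-ren r V sV
  softVal-ren r (bang V)      sV        = softVal-ren r V sV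
  softVal-ren r (μpair p q c) (h , sc)  =
    (λ a b → ≤-trans (≤-reflexive (wtCmd-liftRen₂ r c)) (h a b)) , softCmd-ren _ c sc
  softVal-ren r (μbrace p c)  sc        = softBind-ren r c sc
  softVal-ren r (μbang p c)   sc        = softBind-ren r c sc
  softVal-ren r (μ₋ c)        sc        = softBind-ren r c sc

  softTm-ren r (val V) sV = softVal-ren r V sV
  softTm-ren r (μ₊ c)  sc = softBind-ren r c sc

  softCmd-ren r ⟨ t ∥ u ⟩ (st , su) = softTm-ren r t st , softTm-ren r u su

  softBind-ren r c (h , sc) =
    (λ a → ≤-trans (≤-reflexive (wtCmd-liftRen r c)) (h a)) , softCmd-ren _ c sc

  SoftSub : ∀ {S S′} → Sub S S′ → Set
  SoftSub {S} s = ∀ {p} (x : p ∈ S) → softVal (s x)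

  softSub-lift : ∀ {S S′ q} {s : Sub S S′} → SoftSub s → SoftSub (liftSub {q = q} s)
  softSub-lift ss (here refl) = tt
  softSub-lift {s = s} ss (there x) = softVal-ren there (s x) (ss x)

  -- The images of the free variables do not contain the bound variable, so with everything else at
  -- 0 they weigh 0 by `wtVal-𝟘`. The linear bound at each old binder is therefore unchanged, and
  -- binders inside the images are covered by `SoftSub`.
  softVal-sub : ∀ {S S′ p} {s : Sub S S′} → SoftSub s → (V : Val S p) → softVal V → softVal (subVal s V)
  softTm-sub  : ∀ {S S′ p} {s : Sub S S′} → SoftSub s → (t : Tm S p) → softTm t → softTm (subTm s t)
  softCmd-sub : ∀ {S S′} {s : Sub S S′} → SoftSub s → (c : Cmd S) → softCmd c → softCmd (subCmd s c)
  softBind-sub : ∀ {S S′ q} {s : Sub S S′} → SoftSub s → (c : Cmd (q ∷ S)) {f : ℕ → ℕ} →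
    (∀ a → wtCmd 0 (a ◂ 𝟘) c ≤ f a) × softCmd c →
    (∀ a → wtCmd 0 (a ◂ 𝟘) (subCmd (liftSub s) c) ≤ f a) × softCmd (subCmd (liftSub s) c)

  softVal-sub ss (var x)       _          = ss x
  softVal-sub ss (const k)     _          = tt
  softVal-sub ss (pair V V′)   (sV , sV′) = softVal-sub ss V sV , softVal-sub ss V′ sV′
  softVal-sub ss (brace V)     sV         = softVal-sub ss V sV
  softVal-sub ss (bang V)      sV         = softVal-sub ss V sV
  softVal-sub {s = s} ss (μpair p q c) (h , sc) =
    (λ a b → ≤-trans (≤-reflexive (trans (wtCmd-liftSub₂ s c)
                       (wtCmd-cong (◂-cong (◂-cong (λ x → wtVal-𝟘 (s x)))) c))) (h a b)) ,
    softCmd-sub (softSub-lift (softSub-lift ss)) c sc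
  softVal-sub ss (μbrace p c)  sc         = softBind-sub ss c sc
  softVal-sub ss (μbang p c)   sc         = softBind-sub ss c sc
  softVal-sub ss (μ₋ c)        sc         = softBind-sub ss c sc

  softTm-sub ss (val V) sV = softVal-sub ss V sV
  softTm-sub ss (μ₊ c)  sc = softBind-sub ss c sc

  softCmd-sub ss ⟨ t ∥ u ⟩ (st , su) = softTm-sub ss t st , softTm-sub ss u su

  softBind-sub {s = s} ss c (h , sc) =
    (λ a → ≤-trans (≤-reflexive (trans (wtCmd-liftSub s c)
                     (wtCmd-cong (◂-cong (λ x → wtVal-𝟘 (s x))) c))) (h a)) ,
    softCmd-sub (softSub-lift ss) c sc

  softSub-var : ∀ {S} → SoftSub {S} var
  softSub-var x = tt

  softSub-∷ : ∀ {S S′ q} {V : Val S′ q} {s : Sub S S′} → softVal V → SoftSub s → SoftSub (V ∷ˢ s)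
  softSub-∷ sV ss (here refl) = sV
  softSub-∷ sV ss (there x)   = ss x

  ∷ˢ-weight : ∀ {S S′ q e} {V : Val S′ q} {s : Sub S S′} {p} (x : p ∈ q ∷ S) →
              wtVal e 𝟘 ((V ∷ˢ s) x) ≡ (wtVal e 𝟘 V ◂ (λ y → wtVal e 𝟘 (s y))) x
  ∷ˢ-weight (here refl) = refl
  ∷ˢ-weight (there x)   = refl

  -- Reduction decreases the weight of soft commands

  weight : ∀ {S} → Cmd S → ℕ
  weight = wtCmd 1 𝟘

  -- By affinity, substituting `V` adds to the weight of the body the linear part evaluated at the
  -- weight of `V`. Softness of the binder supplies the bound `k` on it.
  weight-[] : ∀ {S q k} (c : Cmd (q ∷ S)) (V : Val S q) → wtCmd 0 (wtVal 1 𝟘 V ◂ 𝟘) c ≤ k →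
              weight (c [ V ]) ≤ wtCmd 1 (0 ◂ 𝟘) c + k
  weight-[] {k = k} c V h = begin
    weight (c [ V ])                                 ≡⟨ wtCmd-sub (V ∷ˢ var) c ⟩
    wtCmd 1 _ c                                      ≡⟨ wtCmd-cong ∷ˢ-weight c ⟩
    wtCmd 1 (wtVal 1 𝟘 V ◂ 𝟘) c                      ≡⟨ wtCmd-split c ⟩
    wtCmd 1 𝟘 c + wtCmd 0 (wtVal 1 𝟘 V ◂ 𝟘) c        ≡⟨ cong (_+ wtCmd 0 _ c) (wtCmd-cong ◂-𝟘 c) ⟨
    wtCmd 1 (0 ◂ 𝟘) c + wtCmd 0 (wtVal 1 𝟘 V ◂ 𝟘) c  ≤⟨ +-monoʳ-≤ _ h ⟩
    wtCmd 1 (0 ◂ 𝟘) c + k                            ∎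
    where open ≤-Reasoning

  weight-[⨾] : ∀ {S p q k} (c : Cmd (p ∷ q ∷ S)) (V : Val S p) (V′ : Val S q) →
               wtCmd 0 (wtVal 1 𝟘 V ◂ wtVal 1 𝟘 V′ ◂ 𝟘) c ≤ k →
               weight (c [ V ⨾ V′ ]) ≤ wtCmd 1 (0 ◂ 0 ◂ 𝟘) c + k
  weight-[⨾] {k = k} c V V′ h = begin
    weight (c [ V ⨾ V′ ])                            ≡⟨ wtCmd-sub (V ∷ˢ V′ ∷ˢ var) c ⟩
    wtCmd 1 _ c                                      ≡⟨ wtCmd-cong ∷ˢ-weight c ⟩
    wtCmd 1 _ c                                      ≡⟨ wtCmd-cong (◂-cong ∷ˢ-weight) c ⟩
    wtCmd 1 (wtVal 1 𝟘 V ◂ wtVal 1 𝟘 V′ ◂ 𝟘) c       ≡⟨ wtCmd-split c ⟩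
    wtCmd 1 𝟘 c + wtCmd 0 (_ ◂ _ ◂ 𝟘) c              ≡⟨ cong (_+ wtCmd 0 _ c) (wtCmd-cong (◂-zero ◂-𝟘) c) ⟨
    wtCmd 1 (0 ◂ 0 ◂ 𝟘) c + wtCmd 0 (_ ◂ _ ◂ 𝟘) c    ≤⟨ +-monoʳ-≤ _ h ⟩
    wtCmd 1 (0 ◂ 0 ◂ 𝟘) c + k                        ∎
    where open ≤-Reasoning

  ⟶-soft : ∀ {S} {c c′ : Cmd S} → c ⟶ c′ → softCmd c → softCmd c′
  ⟶-soft (red-μ₊ {c})   ((_ , sc) , sV) = softCmd-sub (softSub-∷ sV softSub-var) c sc
  ⟶-soft (red-μ₋ {c = c}) (sV , _ , sc) = softCmd-sub (softSub-∷ sV softSub-var) c sc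
  ⟶-soft (red-brace {c = c}) (sV , _ , sc) = softCmd-sub (softSub-∷ sV softSub-var) c sc
  ⟶-soft (red-pair {c = c}) ((sV , sV′) , _ , sc) =
    softCmd-sub (softSub-∷ sV (softSub-∷ sV′ softSub-var)) c sc
  ⟶-soft (red-bang {c = c}) (sV , _ , sc) = softCmd-sub (softSub-∷ sV softSub-var) c sc

  private
    -- The right-hand side is the weight of a redex whose value weighs `j` and whose binder has a
    -- body of weight `a`; `k` bounds the cost of the substituted copies.
    paid : ∀ {w a} k {j} → w ≤ a + k → k ≤ j → w < suc (j + suc a)
    paid {w} {a} k {j} w≤ k≤j = s≤s (begin
      w          ≤⟨ w≤ ⟩
      a + k      ≤⟨ +-mono-≤ (n≤1+n a) k≤j ⟩
      suc a + j  ≡⟨ +-comm (suc a) j ⟩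
      j + suc a  ∎)
      where open ≤-Reasoning

  ⟶-weight : ∀ {S} {c c′ : Cmd S} → c ⟶ c′ → softCmd c → weight c′ < weight c
  ⟶-weight (red-μ₊ {c} {V}) ((h , _) , _) = s≤s (m≤n⇒m≤1+n (weight-[] c V (h _)))
  ⟶-weight (red-μ₋ {V} {c}) (_ , h , _) = paid (wtVal 1 𝟘 V) (weight-[] c V (h _)) ≤-refl
  ⟶-weight (red-brace {c = c} {V}) (_ , h , _) =
    paid (wtVal 1 𝟘 V) (weight-[] c V (h _)) (n≤1+n _)
  ⟶-weight (red-pair {c = c} {V} {V′}) (_ , h , _) =
    paid (wtVal 1 𝟘 V + wtVal 1 𝟘 V′) (weight-[⨾] c V V′ (h _ _)) (n≤1+n _)
  ⟶-weight (red-bang {c = c} {V}) (_ , h , _) =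
    paid (N * wtVal 1 𝟘 V) (weight-[] c V (h _)) (n≤1+n _)

  -- Commands carry no types here, so stuck ones such as a pair against a `μbrace` occur. A redex
  -- also needs the polarities of value and binder to agree, which is decided by `≟`.
  reduce? : ∀ {S} (c : Cmd S) → (∃[ c′ ] c ⟶ c′) ⊎ IsNormalForm _⟶_ c
  reduce? ⟨ μ₊ c ∥ val V ⟩                        = inj₁ (_ , red-μ₊)
  reduce? ⟨ val V ∥ val (μ₋ c) ⟩                  = inj₁ (_ , red-μ₋)
  reduce? ⟨ val V ∥ val (var α) ⟩                 = inj₂ λ ()
  reduce? ⟨ val V ∥ val (const k) ⟩               = inj₂ λ ()
  reduce? ⟨ val (var x) ∥ val (μpair p q c) ⟩     = inj₂ λ ()
  reduce? ⟨ val (const k) ∥ val (μpair p q c) ⟩   = inj₂ λ ()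
  reduce? ⟨ val (brace V) ∥ val (μpair p q c) ⟩   = inj₂ λ ()
  reduce? ⟨ val (bang V) ∥ val (μpair p q c) ⟩    = inj₂ λ ()
  reduce? ⟨ val (pair {p′} {q′} V V′) ∥ val (μpair p q c) ⟩ with p′ ≟ p | q′ ≟ q
  ... | yes refl | yes refl = inj₁ (_ , red-pair)
  ... | no p′≢p  | _        = inj₂ λ { (_ , red-pair) → p′≢p refl }
  ... | yes _    | no q′≢q  = inj₂ λ { (_ , red-pair) → q′≢q refl }
  reduce? ⟨ val (var x) ∥ val (μbrace p c) ⟩      = inj₂ λ ()
  reduce? ⟨ val (const k) ∥ val (μbrace p c) ⟩    = inj₂ λ ()
  reduce? ⟨ val (pair V V′) ∥ val (μbrace p c) ⟩  = inj₂ λ ()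
  reduce? ⟨ val (bang V) ∥ val (μbrace p c) ⟩     = inj₂ λ ()
  reduce? ⟨ val (brace {p′} V) ∥ val (μbrace p c) ⟩ with p′ ≟ p
  ... | yes refl = inj₁ (_ , red-brace)
  ... | no p′≢p  = inj₂ λ { (_ , red-brace) → p′≢p refl }
  reduce? ⟨ val (var x) ∥ val (μbang p c) ⟩       = inj₂ λ ()
  reduce? ⟨ val (const k) ∥ val (μbang p c) ⟩     = inj₂ λ ()
  reduce? ⟨ val (pair V V′) ∥ val (μbang p c) ⟩   = inj₂ λ ()
  reduce? ⟨ val (brace V) ∥ val (μbang p c) ⟩     = inj₂ λ ()
  reduce? ⟨ val (bang {p′} V) ∥ val (μbang p c) ⟩ with p′ ≟ p
  ... | yes refl = inj₁ (_ , red-bang)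
  ... | no p′≢p  = inj₂ λ { (_ , red-bang) → p′≢p refl }

  normalizesWithin : ∀ {S} m (c : Cmd S) → softCmd c → weight c ≤ m → CmdNormalizesWithin m c
  normalizesWithin m c sc w≤m with reduce? c
  normalizesWithin m c sc w≤m | inj₂ nf = 0 , c , z≤n , done , nf
  -- A reduct would have weight below 0.
  normalizesWithin zero c sc w≤m | inj₁ (c′ , r) with () ← ≤-trans (⟶-weight r sc) w≤m
  normalizesWithin (suc m) c sc w≤m | inj₁ (c′ , r)
    with n , c″ , n≤m , rs , nf ←
      normalizesWithin m c′ (⟶-soft r sc) (s≤s⁻¹ (≤-trans (⟶-weight r sc) w≤m))
    = suc n , c″ , s≤s n≤m , step r rs , nf

  -- Sizes, and the term `!_S V`

  sizeVal-ren : ∀ {S S′ p} (r : S ⊆ S′) (V : Val S p) → sizeVal (renVal r V) ≡ sizeVal V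
  size-ren    : ∀ {S S′ p} (r : S ⊆ S′) (t : Tm S p) → size (renTm r t) ≡ size t
  sizeCmd-ren : ∀ {S S′} (r : S ⊆ S′) (c : Cmd S) → sizeCmd (renCmd r c) ≡ sizeCmd c

  sizeVal-ren r (var x)       = refl
  sizeVal-ren r (const k)     = refl
  sizeVal-ren r (pair V V′)   = cong suc (cong₂ _+_ (sizeVal-ren r V) (sizeVal-ren r V′))
  sizeVal-ren r (brace V)     = cong suc (sizeVal-ren r V)
  sizeVal-ren r (bang V)      = cong suc (sizeVal-ren r V)
  sizeVal-ren r (μpair p q c) = cong suc (sizeCmd-ren _ c)
  sizeVal-ren r (μbrace p c)  = cong suc (sizeCmd-ren _ c)
  sizeVal-ren r (μbang p c)   = cong suc (sizeCmd-ren _ c)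
  sizeVal-ren r (μ₋ c)        = cong suc (sizeCmd-ren _ c)

  size-ren r (val V) = sizeVal-ren r V
  size-ren r (μ₊ c)  = cong suc (sizeCmd-ren _ c)

  sizeCmd-ren r ⟨ t ∥ u ⟩ = cong suc (cong₂ _+_ (size-ren r t) (size-ren r u))

  -- Each variable of the list contributes three symbols: a command, the variable and its `μbang`.
  -- The innermost command adds itself, the `bang` and `α` to the size of `V`.
  sizeCmd-bangCmd : ∀ {S p} xs (V : Val S p) (α : neg ∈ S) →
                    sizeCmd (bangCmd xs V α) ≡ length xs * 3 + (3 + sizeVal V)
  sizeCmd-bangCmd []       V α = cong (2 +_) (+-comm (sizeVal V) 1)
  sizeCmd-bangCmd (x ∷ xs) V α =
    cong (3 +_) (trans (sizeCmd-ren (capture x) (bangCmd xs V α)) (sizeCmd-bangCmd xs V α))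

  size-bangTm : ∀ {S p} xs (V : Val S p) → size (bangTm xs V) ≡ suc (length xs * 3 + (3 + sizeVal V))
  size-bangTm xs V = cong suc (trans (sizeCmd-bangCmd (map there xs) _ _)
    (cong₂ (λ k s → k * 3 + (3 + s)) (length-map there xs) (sizeVal-ren there V)))

  length≤size-bangTm : ∀ {S p} xs (V : Val S p) → length xs ≤ size (bangTm xs V)
  length≤size-bangTm xs V = begin
    length xs                              ≤⟨ m≤m*n (length xs) 3 ⟩
    length xs * 3                          ≤⟨ m≤m+n _ _ ⟩
    length xs * 3 + (3 + sizeVal V)        ≤⟨ n≤1+n _ ⟩
    suc (length xs * 3 + (3 + sizeVal V))  ≡⟨ size-bangTm xs V ⟨
    size (bangTm xs V)                     ∎
    where open ≤-Reasoning

  sizeVal≤size-bangTm : ∀ {S p} xs (V : Val S p) → sizeVal V ≤ size (bangTm xs V)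
  sizeVal≤size-bangTm xs V = begin
    sizeVal V                              ≤⟨ m≤n+m _ 3 ⟩
    3 + sizeVal V                          ≤⟨ m≤n+m _ (length xs * 3) ⟩
    length xs * 3 + (3 + sizeVal V)        ≤⟨ n≤1+n _ ⟩
    suc (length xs * 3 + (3 + sizeVal V))  ≡⟨ size-bangTm xs V ⟨
    size (bangTm xs V)                     ∎
    where open ≤-Reasoning

  1≤sizeVal : ∀ {S p} (V : Val S p) → 1 ≤ sizeVal V
  1≤sizeVal (var x)       = ≤-refl
  1≤sizeVal (const k)     = ≤-refl
  1≤sizeVal (pair V V′)   = s≤s z≤n
  1≤sizeVal (brace V)     = s≤s z≤n
  1≤sizeVal (bang V)      = s≤s z≤n
  1≤sizeVal (μpair p q c) = s≤s z≤n
  1≤sizeVal (μbrace p c)  = s≤s z≤n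
  1≤sizeVal (μbang p c)   = s≤s z≤n
  1≤sizeVal (μ₋ c)        = s≤s z≤n

  1≤size : ∀ {S p} (t : Tm S p) → 1 ≤ size t
  1≤size (val V) = 1≤sizeVal V
  1≤size (μ₊ c)  = s≤s z≤n

  -- Capturing x sets its weight to 0 inside the box; the summand for x is its
  -- occurrence outside of it.
  bangCmd-occ : ∀ {S p} xs (V : Val S p) (α : neg ∈ S) (ρ : Env S) →
                wtCmd 0 ρ (bangCmd xs V α) ≤ sumAt ρ xs + (N * wtVal 0 (zeroAll xs ρ) V + ρ α)
  bangCmd-occ []       V α ρ = ≤-refl
  bangCmd-occ (x ∷ xs) V α ρ = begin
    ρ x + wtCmd 0 (0 ◂ ρ) (renCmd (capture x) b)
      ≡⟨ cong (ρ x +_) (wtCmd-ren (capture x) b) ⟩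
    ρ x + wtCmd 0 (zeroAt x ρ) b
      ≤⟨ +-monoʳ-≤ (ρ x) (bangCmd-occ xs V α (zeroAt x ρ)) ⟩
    ρ x + (sumAt (zeroAt x ρ) xs + (w + zeroAt x ρ α))
      ≤⟨ +-monoʳ-≤ (ρ x) (+-mono-≤ (sumAt-mono {ρ = zeroAt x ρ} {ρ} (zeroAt-≤ x ρ) xs)
                                   (+-monoʳ-≤ w (zeroAt-≤ x ρ α))) ⟩
    ρ x + (sumAt ρ xs + (w + ρ α))
      ≡⟨ +-assoc (ρ x) _ _ ⟨
    ρ x + sumAt ρ xs + (w + ρ α) ∎
    where
    open ≤-Reasoning
    b = bangCmd xs V α
    w = N * wtVal 0 (zeroAll xs (zeroAt x ρ)) V

  -- By hypothesis all weight of variables in `V` stems from `xs`, and these are captured and weigh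
  -- 0 inside. The summand multiplied by `N` vanishes, leaving one occurrence of each variable at
  -- depth 0.
  bangCmd-occ-closed : ∀ {S p} xs (V : Val S p) (α : neg ∈ S) →
                       (∀ (ρ : Env S) → wtVal 0 ρ V ≤ sumAt ρ xs) →
                       (ρ : Env S) → wtCmd 0 ρ (bangCmd xs V α) ≤ sumAt ρ xs + ρ α
  bangCmd-occ-closed xs V α h ρ = begin
    wtCmd 0 ρ (bangCmd xs V α)                           ≤⟨ bangCmd-occ xs V α ρ ⟩
    sumAt ρ xs + (N * wtVal 0 (zeroAll xs ρ) V + ρ α)    ≡⟨ cong (λ w → sumAt ρ xs + (N * w + ρ α)) V≡0 ⟩
    sumAt ρ xs + (N * 0 + ρ α)                           ≡⟨ cong (λ w → sumAt ρ xs + (w + ρ α)) (*-zeroʳ N) ⟩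
    sumAt ρ xs + ρ α                                     ∎
    where
    open ≤-Reasoning
    V≡0 : wtVal 0 (zeroAll xs ρ) V ≡ 0
    V≡0 = n≤0⇒n≡0 (≤-trans (h (zeroAll xs ρ))
                           (≤-reflexive (sumAt-zero {ρ = zeroAll xs ρ} xs (zeroAll-∈ xs ρ))))

  wtVal-weaken-≤ : ∀ {S p q} {xs} (V : Val S p) → (∀ (ρ : Env S) → wtVal 0 ρ V ≤ sumAt ρ xs) →
                   (ρ : Env (q ∷ S)) → wtVal 0 ρ (renVal there V) ≤ sumAt ρ (map there xs)
  wtVal-weaken-≤ {xs = xs} V h ρ = begin
    wtVal 0 ρ (renVal there V)       ≡⟨ wtVal-ren there V ⟩
    wtVal 0 (λ x → ρ (there x)) V    ≤⟨ h _ ⟩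
    sumAt (λ x → ρ (there x)) xs     ≡⟨ sumAt-there ρ xs ⟨
    sumAt ρ (map there xs)           ∎
    where open ≤-Reasoning

  -- Here `a` is the weight of the variable bound by the outer `μ₊`: `a = 0` gives the weight of the
  -- whole term, `ρ = 𝟘` the softness of that binder.
  bangTm-occ : ∀ {S p} xs (V : Val S p) → (∀ (ρ : Env S) → wtVal 0 ρ V ≤ sumAt ρ xs) →
               ∀ a (ρ : Env S) →
               wtCmd 0 (a ◂ ρ) (bangCmd (map there xs) (renVal there V) (here refl)) ≤ sumAt ρ xs + a
  bangTm-occ xs V h a ρ = ≤-trans
    (bangCmd-occ-closed (map there xs) (renVal there V) (here refl) (wtVal-weaken-≤ {xs = xs} V h) (a ◂ ρ))
    (≤-reflexive (cong (_+ a) (sumAt-there (a ◂ ρ) xs)))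

  -- The list `zs` of all variables of `V` stays fixed while `xs` shrinks in the induction. A
  -- captured `x` is not among the remaining `xs`, so it occurs only in `V`, at most once since `zs`
  -- has no repetitions, and below a single `bang`: this gives exactly the factor `N` that `μbang`
  -- allows.
  bangCmd-soft : ∀ {S p zs} xs (V : Val S p) (α : neg ∈ S) →
                 (∀ (ρ : Env S) → wtVal 0 ρ V ≤ sumAt ρ zs) → Unique zs →
                 softVal V → Unique xs → softCmd (bangCmd xs V α)
  bangCmd-soft [] V α h uz sV _ = sV , tt
  bangCmd-soft {zs = zs} (x ∷ xs) V α h uz sV (x∉ ∷ u) =
    tt , bound , softCmd-ren (capture x) b (bangCmd-soft xs V α h uz sV u)
    where
    open ≤-Reasoning
    b = bangCmd xs V α
    α≡0 : ∀ a → (a ◂ 𝟘) (capture x α) ≡ 0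
    α≡0 a with capture x α | captured x α
    -- The case `same` is impossible: `x` is positive and `α` negative.
    ... | .(there α) | other = refl
    bound : ∀ a → wtCmd 0 (a ◂ 𝟘) (renCmd (capture x) b) ≤ N * a
    bound a = begin
      wtCmd 0 (a ◂ 𝟘) (renCmd (capture x) b)                 ≡⟨ wtCmd-ren (capture x) b ⟩
      wtCmd 0 ρ b                                            ≤⟨ bangCmd-occ xs V α ρ ⟩
      sumAt ρ xs + (N * wtVal 0 (zeroAll xs ρ) V + ρ α)
        ≡⟨ cong₂ (λ m n → m + (N * wtVal 0 (zeroAll xs ρ) V + n))
                 (sumAt-capture-∉ (All¬⇒¬Any x∉)) (α≡0 a) ⟩
      N * wtVal 0 (zeroAll xs ρ) V + 0                       ≡⟨ +-identityʳ _ ⟩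
      N * wtVal 0 (zeroAll xs ρ) V                           ≤⟨ *-monoʳ-≤ N (wtVal-mono (zeroAll-≤ xs ρ) V) ⟩
      N * wtVal 0 ρ V                                        ≤⟨ *-monoʳ-≤ N (h ρ) ⟩
      N * sumAt ρ zs                                         ≤⟨ *-monoʳ-≤ N (sumAt-capture {x = x} uz) ⟩
      N * a                                                  ∎
      where
      ρ : Env _
      ρ y = (a ◂ 𝟘) (capture x y)

  -- Occurrences of variables in typed terms

  -- Declarations are used affinely: rules with two premises split the context, weakening only adds
  -- to the right-hand side, `ty-M` binds the merged variables at once, and `!_S V` has one free
  -- occurrence of each variable of `S`.
  tm-occ  : ∀ {Θ S p} {t : Tm S p} {A : Form Θ p} {Γ} → ⊢ t ∶ A ∣ Γ →
            (ρ : Env S) → wtTm 0 ρ t ≤ total Γ ρ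
  cmd-occ : ∀ {Θ S} {c : Cmd S} {Γ : Ctx Θ S} → c ∶⊢ Γ → (ρ : Env S) → wtCmd 0 ρ c ≤ total Γ ρ
  decls-occ : ∀ {Θ S p} {V : Val S p} {A : Form Θ p} ds → ⊢ val V ∶ A ∣ decls ds →
              (ρ : Env S) → wtVal 0 ρ V ≤ sumAt ρ (map proj₁ ds)

  tm-occ (ax x A) ρ = ≤-trans (m≤m+n _ _) (≤-reflexive (sym (total-≔ ∅ x ρ (lookup-∅ x))))
  tm-occ (ty-μ₊ π) ρ = cmd-occ π (0 ◂ ρ)
  tm-occ (ty-μ₋ π) ρ = cmd-occ π (0 ◂ ρ)
  tm-occ (ty-⊗ π π′ s) ρ = ≤-trans (+-mono-≤ (tm-occ π ρ) (tm-occ π′ ρ)) (≤-reflexive (total-⊎ s ρ))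
  tm-occ (ty-⅋ π) ρ = cmd-occ π (0 ◂ 0 ◂ ρ)
  tm-occ (ty-↓ π) ρ = tm-occ π ρ
  tm-occ (ty-↑ π) ρ = cmd-occ π (0 ◂ ρ)
  tm-occ (ty-∃ T π) ρ = tm-occ π ρ
  tm-occ (ty-∀ {Γ = Γ} π) ρ = ≤-trans (tm-occ π ρ) (≤-reflexive (total-wk Γ ρ))
  tm-occ (ty-! {V = V} ds u π) ρ = begin
    wtTm 0 ρ (bangTm xs V)                   ≤⟨ bangTm-occ xs V (decls-occ ds π) 0 ρ ⟩
    sumAt ρ xs + 0                           ≡⟨ +-identityʳ _ ⟩
    sumAt ρ xs                               ≡⟨ cong (sumAt ρ) (map-∘ ds) ⟩
    sumAt ρ (map proj₁ (map (map₂ ⁇) ds))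
      ≡⟨ total-decls (map (map₂ ⁇) ds) ρ (subst Unique (map-∘ ds) u) ⟨
    total (decls (map (map₂ ⁇) ds)) ρ        ∎
    where
    open ≤-Reasoning
    xs = map proj₁ ds
  tm-occ (ty-M n {c = c} {Γ = Γ} π) ρ = begin
    wtCmd 0 (0 ◂ ρ) (renCmd (merge n) c)           ≡⟨ wtCmd-ren (merge n) c ⟩
    wtCmd 0 (λ x → (0 ◂ ρ) (merge n x)) c          ≤⟨ cmd-occ π _ ⟩
    total (copies n _ Γ) (λ x → (0 ◂ ρ) (merge n x)) ≡⟨ total-copies n Γ ρ ⟩
    total Γ ρ                                      ∎
    where open ≤-Reasoning

  cmd-occ (cut {p = pos} π π′ s) ρ =
    ≤-trans (+-mono-≤ (tm-occ π ρ) (tm-occ π′ ρ)) (≤-reflexive (total-⊎ s ρ))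
  cmd-occ (cut {p = neg} {Γ = Γ} π π′ s) ρ =
    ≤-trans (+-mono-≤ (tm-occ π′ ρ) (tm-occ π ρ))
            (≤-reflexive (trans (+-comm _ (total Γ ρ)) (total-⊎ s ρ)))
  cmd-occ (conv {Γ = Γ} κ _ π) ρ = ≤-trans (cmd-occ π ρ) (≤-reflexive (total-≔-formula Γ κ ρ))
  cmd-occ (weak {Γ = Γ} κ A eq π) ρ =
    ≤-trans (cmd-occ π ρ) (≤-trans (m≤n+m _ (ρ κ)) (≤-reflexive (sym (total-≔ Γ κ ρ eq))))

  decls-occ ds π ρ = ≤-trans (tm-occ π ρ) (total-decls-≤ ds ρ)

  private
    scale-+ : ∀ {m n} k l b → m ≤ k * b → n ≤ l * b → m + n ≤ (k + l) * b
    scale-+ k l b m≤ n≤ =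
      ≤-trans (+-mono-≤ m≤ n≤) (≤-reflexive (sym (*-distribʳ-+ b k l)))

    -- Accounts for the outermost symbol when symbols cost 1; `scale-skip` does so when they cost 0.
    scale-suc : ∀ {m} k {b} → 1 ≤ b → m ≤ k * b → suc m ≤ suc k * b
    scale-suc k 1≤b m≤ = +-mono-≤ 1≤b m≤

    scale-skip : ∀ {m} k b → m ≤ k * b → m ≤ suc k * b
    scale-skip k b m≤ = ≤-trans m≤ (m≤n+m _ b)

  -- Free variables of a typable term occur at depth 0 only, so their
  -- occurrences are not multiplied by N.
  tm-occ-size  : ∀ {Θ S p a} {t : Tm S p} {A : Form Θ p} {Γ} {ρ : Env S} → ⊢ t ∶ A ∣ Γ →
                 (∀ {q} (x : q ∈ S) → ρ x ≤ a) → wtTm 0 ρ t ≤ size t * a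
  cmd-occ-size : ∀ {Θ S a} {c : Cmd S} {Γ : Ctx Θ S} {ρ : Env S} → c ∶⊢ Γ →
                 (∀ {q} (x : q ∈ S) → ρ x ≤ a) → wtCmd 0 ρ c ≤ sizeCmd c * a

  tm-occ-size {a = a} (ax x A) h = ≤-trans (h x) (≤-reflexive (sym (*-identityˡ a)))
  tm-occ-size {a = a} (ty-μ₊ {c} π) h = scale-skip (sizeCmd c) a (cmd-occ-size π (◂-bound z≤n h))
  tm-occ-size {a = a} (ty-μ₋ {c} π) h = scale-skip (sizeCmd c) a (cmd-occ-size π (◂-bound z≤n h))
  tm-occ-size {a = a} (ty-⊗ {V = V} {V′} π π′ _) h =
    scale-skip (sizeVal V + sizeVal V′) a
      (scale-+ (sizeVal V) (sizeVal V′) a (tm-occ-size π h) (tm-occ-size π′ h))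
  tm-occ-size {a = a} (ty-⅋ {c = c} π) h =
    scale-skip (sizeCmd c) a (cmd-occ-size π (◂-bound z≤n (◂-bound z≤n h)))
  tm-occ-size {a = a} (ty-↓ {V = V} π) h = scale-skip (sizeVal V) a (tm-occ-size π h)
  tm-occ-size {a = a} (ty-↑ {c = c} π) h = scale-skip (sizeCmd c) a (cmd-occ-size π (◂-bound z≤n h))
  tm-occ-size (ty-∃ T π) h = tm-occ-size π h
  tm-occ-size (ty-∀ π) h = tm-occ-size π h
  tm-occ-size {a = a} {ρ = ρ} (ty-! {V = V} ds u π) h = begin
    wtTm 0 ρ (bangTm xs V)     ≤⟨ bangTm-occ xs V (decls-occ ds π) 0 ρ ⟩
    sumAt ρ xs + 0             ≡⟨ +-identityʳ _ ⟩
    -- One occurrence for each variable of the box, and the box has more symbols than variables.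
    sumAt ρ xs                 ≤⟨ sumAt-bound {ρ = ρ} h xs ⟩
    length xs * a              ≤⟨ *-monoˡ-≤ a (length≤size-bangTm xs V) ⟩
    size (bangTm xs V) * a     ∎
    where
    open ≤-Reasoning
    xs = map proj₁ ds
  tm-occ-size {a = a} {ρ = ρ} (ty-M n {c = c} π) h = scale-skip (sizeCmd (renCmd (merge n) c)) a (begin
    wtCmd 0 (0 ◂ ρ) (renCmd (merge n) c)   ≡⟨ wtCmd-ren (merge n) c ⟩
    wtCmd 0 (λ x → (0 ◂ ρ) (merge n x)) c  ≤⟨ cmd-occ-size π (λ x → ◂-bound {ρ = ρ} z≤n h (merge n x)) ⟩
    sizeCmd c * a                          ≡⟨ cong (_* a) (sizeCmd-ren (merge n) c) ⟨
    sizeCmd (renCmd (merge n) c) * a       ∎)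
    where open ≤-Reasoning

  cmd-occ-size {a = a} (cut {p = pos} {t} {u} π π′ _) h =
    scale-skip (size t + size u) a (scale-+ (size t) (size u) a (tm-occ-size π h) (tm-occ-size π′ h))
  cmd-occ-size {a = a} (cut {p = neg} {t} {u} π π′ _) h =
    scale-skip (size u + size t) a (scale-+ (size u) (size t) a (tm-occ-size π′ h) (tm-occ-size π h))
  cmd-occ-size (conv κ _ π) h = cmd-occ-size π h
  cmd-occ-size (weak κ A _ π) h = cmd-occ-size π h

  -- Typed terms are soft

  private
    occ₁ : ∀ {Θ S q} {c : Cmd (q ∷ S)} {A} {Γ : Ctx Θ S} → c ∶⊢ just A ∷ Γ →
           ∀ a → wtCmd 0 (a ◂ 𝟘) c ≤ a
    occ₁ {Γ = Γ} π a =
      ≤-trans (cmd-occ π (a ◂ 𝟘)) (≤-reflexive (trans (cong (a +_) (total-𝟘 Γ)) (+-identityʳ a)))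

    occ₂ : ∀ {Θ S q q′} {c : Cmd (q ∷ q′ ∷ S)} {A B} {Γ : Ctx Θ S} → c ∶⊢ just A ∷ just B ∷ Γ →
           ∀ a b → wtCmd 0 (a ◂ b ◂ 𝟘) c ≤ a + b
    occ₂ {Γ = Γ} π a b =
      ≤-trans (cmd-occ π (a ◂ b ◂ 𝟘))
              (≤-reflexive (cong (a +_) (trans (cong (b +_) (total-𝟘 Γ)) (+-identityʳ b))))

  -- The affine binders are handled by `cmd-occ` with all other variables at 0, the merging ones by
  -- `cmd-occ-size`. Subterms are no larger than the whole term, so the same `N` serves throughout.
  tm-soft  : ∀ {Θ S p} {t : Tm S p} {A : Form Θ p} {Γ} → ⊢ t ∶ A ∣ Γ → size t ≤ N → softTm t
  cmd-soft : ∀ {Θ S} {c : Cmd S} {Γ : Ctx Θ S} → c ∶⊢ Γ → sizeCmd c ≤ N → softCmd c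

  tm-soft (ax x A) _ = tt
  tm-soft (ty-μ₊ π) ≤N = occ₁ π , cmd-soft π (<⇒≤ ≤N)
  tm-soft (ty-μ₋ π) ≤N = occ₁ π , cmd-soft π (<⇒≤ ≤N)
  tm-soft (ty-⊗ {V = V} π π′ _) ≤N =
    tm-soft π (m+n≤o⇒m≤o _ (<⇒≤ ≤N)) , tm-soft π′ (m+n≤o⇒n≤o (sizeVal V) (<⇒≤ ≤N))
  tm-soft (ty-⅋ π) ≤N = occ₂ π , cmd-soft π (<⇒≤ ≤N)
  tm-soft (ty-↓ π) ≤N = tm-soft π (<⇒≤ ≤N)
  tm-soft (ty-↑ π) ≤N = occ₁ π , cmd-soft π (<⇒≤ ≤N)
  tm-soft (ty-∃ T π) ≤N = tm-soft π ≤N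
  tm-soft (ty-∀ π) ≤N = tm-soft π ≤N
  tm-soft (ty-! {V = V} ds u π) ≤N =
    (λ a → ≤-trans (bangTm-occ xs V h a 𝟘)
                   (≤-reflexive (cong (_+ a) (sumAt-zero {ρ = 𝟘} xs (λ _ → refl))))) ,
    -- The full list is both the list of variables still to be captured and that of the variables of
    -- `V`.
    bangCmd-soft (map there xs) (renVal there V) (here refl) (wtVal-weaken-≤ {xs = xs} V h) u′
      (softVal-ren there V (tm-soft π (≤-trans (sizeVal≤size-bangTm xs V) ≤N))) u′
    where
    xs = map proj₁ ds
    h = decls-occ ds π
    u′ = Unique-map⁺ there-injective u
  tm-soft (ty-M n {c = c} π) ≤N = bound , softCmd-ren (merge n) c (cmd-soft π c≤N)
    where
    open ≤-Reasoning
    c≤N : sizeCmd c ≤ N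
    c≤N = ≤-trans (≤-reflexive (sym (sizeCmd-ren (merge n) c))) (<⇒≤ ≤N)
    bound : ∀ a → wtCmd 0 (a ◂ 𝟘) (renCmd (merge n) c) ≤ N * a
    bound a = begin
      wtCmd 0 (a ◂ 𝟘) (renCmd (merge n) c)   ≡⟨ wtCmd-ren (merge n) c ⟩
      wtCmd 0 (λ x → (a ◂ 𝟘) (merge n x)) c
        -- Every merged variable weighs `a`, so the weight is bounded by `a` for each symbol of the
        -- body, whatever `n` is.
        ≤⟨ cmd-occ-size π (λ x → ◂-bound {ρ = 𝟘} ≤-refl (λ _ → z≤n) (merge n x)) ⟩
      sizeCmd c * a                          ≤⟨ *-monoˡ-≤ a c≤N ⟩
      N * a                                  ∎

  cmd-soft (cut {p = pos} {t} π π′ _) ≤N =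
    tm-soft π (m+n≤o⇒m≤o _ (<⇒≤ ≤N)) , tm-soft π′ (m+n≤o⇒n≤o (size t) (<⇒≤ ≤N))
  cmd-soft (cut {p = neg} {u = u} π π′ _) ≤N =
    tm-soft π′ (m+n≤o⇒m≤o _ (<⇒≤ ≤N)) , tm-soft π (m+n≤o⇒n≤o (size u) (<⇒≤ ≤N))
  cmd-soft (conv κ _ π) ≤N = cmd-soft π ≤N
  cmd-soft (weak κ A _ π) ≤N = cmd-soft π ≤N

  -- The weight is bounded through the depth

  module _ {{_ : NonZero N}} where

    private
      1≤N^ : ∀ d → 1 ≤ N ^ d
      1≤N^ d = m^n>0 N d

      scale-≤ : ∀ {m} k {d d′} → d ≤ d′ → m ≤ k * N ^ d → m ≤ k * N ^ d′
      scale-≤ k d≤d′ m≤ = ≤-trans m≤ (*-monoʳ-≤ k (^-monoʳ-≤ N d≤d′))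

    -- However many `μbang` surround it, `V` lies below a single `bang`, so the exponent grows by
    -- one only. The hypothesis on `V` ranges over all environments that vanish pointwise, because
    -- each capture changes the environment.
    bangCmd-weight : ∀ {S p d} xs (V : Val S p) (α : neg ∈ S) {ρ : Env S} →
      (∀ {ρ : Env S} → (∀ {q} (x : q ∈ S) → ρ x ≡ 0) → wtVal 1 ρ V ≤ sizeVal V * N ^ d) →
      (∀ {q} (x : q ∈ S) → ρ x ≡ 0) →
      wtCmd 1 ρ (bangCmd xs V α) ≤ sizeCmd (bangCmd xs V α) * N ^ suc d
    bangCmd-weight {d = d} [] V α h ρ≡0 =
      scale-suc (suc (sizeVal V) + 1) (1≤N^ (suc d))
        (scale-+ (suc (sizeVal V)) 1 (N ^ suc d) (scale-suc (sizeVal V) (1≤N^ (suc d)) (begin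
            N * wtVal 1 _ V          ≤⟨ *-monoʳ-≤ N (h ρ≡0) ⟩
            N * (sizeVal V * N ^ d)  ≡⟨ x*yz≡y*xz N (sizeVal V) (N ^ d) ⟩
            sizeVal V * (N * N ^ d)  ∎))
          (≤-trans (≤-reflexive (ρ≡0 α)) z≤n))
      where open ≤-Reasoning
    bangCmd-weight {d = d} (x ∷ xs) V α {ρ} h ρ≡0 =
      scale-suc (1 + suc (sizeCmd (renCmd (capture x) b))) (1≤N^ (suc d))
        (scale-+ 1 (suc (sizeCmd (renCmd (capture x) b))) (N ^ suc d) (≤-trans (≤-reflexive (ρ≡0 x)) z≤n)
          (scale-suc (sizeCmd (renCmd (capture x) b)) (1≤N^ (suc d)) (begin
            wtCmd 1 (0 ◂ ρ) (renCmd (capture x) b)      ≡⟨ wtCmd-ren (capture x) b ⟩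
            wtCmd 1 (zeroAt x ρ) b
              ≤⟨ bangCmd-weight {d = d} xs V α h (λ y → ◂-zero ρ≡0 (capture x y)) ⟩
            sizeCmd b * N ^ suc d                       ≡⟨ cong (_* N ^ suc d) (sizeCmd-ren (capture x) b) ⟨
            sizeCmd (renCmd (capture x) b) * N ^ suc d  ∎)))
      where
      open ≤-Reasoning
      b = bangCmd xs V α

    -- Induction on the derivation, since `δ` is defined on it. Only `ty-!` multiplies the weight of
    -- a subterm by `N`, and it raises the depth by one; every other symbol costs 1, which is at
    -- most any power of `N`.
    tm-weight  : ∀ {Θ S p} {t : Tm S p} {A : Form Θ p} {Γ} (π : ⊢ t ∶ A ∣ Γ) {ρ : Env S} →
                 (∀ {q} (x : q ∈ S) → ρ x ≡ 0) → wtTm 1 ρ t ≤ size t * N ^ δ π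
    cmd-weight : ∀ {Θ S} {c : Cmd S} {Γ : Ctx Θ S} (π : c ∶⊢ Γ) {ρ : Env S} →
                 (∀ {q} (x : q ∈ S) → ρ x ≡ 0) → wtCmd 1 ρ c ≤ sizeCmd c * N ^ δCmd π

    tm-weight (ax x A) h = ≤-trans (≤-reflexive (h x)) z≤n
    tm-weight (ty-μ₊ {c} π) h = scale-suc (sizeCmd c) (1≤N^ (δCmd π)) (cmd-weight π (◂-zero h))
    tm-weight (ty-μ₋ {c} π) h = scale-suc (sizeCmd c) (1≤N^ (δCmd π)) (cmd-weight π (◂-zero h))
    tm-weight (ty-⊗ {V = V} {V′} π π′ _) h =
      scale-suc (sizeVal V + sizeVal V′) (1≤N^ (δ π ⊔ δ π′))
        (scale-+ (sizeVal V) (sizeVal V′) (N ^ (δ π ⊔ δ π′))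
          (scale-≤ (sizeVal V) (m≤m⊔n (δ π) (δ π′)) (tm-weight π h))
          (scale-≤ (sizeVal V′) (m≤n⊔m (δ π) (δ π′)) (tm-weight π′ h)))
    tm-weight (ty-⅋ {c = c} π) h =
      scale-suc (sizeCmd c) (1≤N^ (δCmd π)) (cmd-weight π (◂-zero (◂-zero h)))
    tm-weight (ty-↓ {V = V} π) h = scale-suc (sizeVal V) (1≤N^ (δ π)) (tm-weight π h)
    tm-weight (ty-↑ {c = c} π) h = scale-suc (sizeCmd c) (1≤N^ (δCmd π)) (cmd-weight π (◂-zero h))
    tm-weight (ty-∃ T π) h = tm-weight π h
    tm-weight (ty-∀ π) h = tm-weight π h
    tm-weight {S = S} (ty-! {V = V} ds u π) h =
      scale-suc (sizeCmd (bangCmd xs V′ (here refl))) (1≤N^ (suc (δ π)))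
        (bangCmd-weight {d = δ π} xs V′ (here refl) V′-weight (◂-zero h))
      where
      open ≤-Reasoning
      xs = map there (map proj₁ ds)
      V′ = renVal there V
      V′-weight : {ρ : Env (neg ∷ S)} → (∀ {q} (x : q ∈ neg ∷ S) → ρ x ≡ 0) →
                  wtVal 1 ρ V′ ≤ sizeVal V′ * N ^ δ π
      V′-weight {ρ} ρ≡0 = begin
        wtVal 1 ρ V′                   ≡⟨ wtVal-ren there V ⟩
        wtVal 1 (λ x → ρ (there x)) V  ≤⟨ tm-weight π (λ x → ρ≡0 (there x)) ⟩
        sizeVal V * N ^ δ π            ≡⟨ cong (_* N ^ δ π) (sizeVal-ren there V) ⟨
        sizeVal V′ * N ^ δ π           ∎
    tm-weight (ty-M n {c = c} π) {ρ} h = scale-suc (sizeCmd (renCmd (merge n) c)) (1≤N^ (δCmd π)) (begin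
      wtCmd 1 (0 ◂ ρ) (renCmd (merge n) c)       ≡⟨ wtCmd-ren (merge n) c ⟩
      wtCmd 1 (λ x → (0 ◂ ρ) (merge n x)) c      ≤⟨ cmd-weight π (λ x → ◂-zero h (merge n x)) ⟩
      sizeCmd c * N ^ δCmd π                     ≡⟨ cong (_* N ^ δCmd π) (sizeCmd-ren (merge n) c) ⟨
      sizeCmd (renCmd (merge n) c) * N ^ δCmd π  ∎)
      where open ≤-Reasoning

    cmd-weight (cut {p = pos} {t} {u} π π′ _) h =
      scale-suc (size t + size u) (1≤N^ (δ π ⊔ δ π′))
        (scale-+ (size t) (size u) (N ^ (δ π ⊔ δ π′))
          (scale-≤ (size t) (m≤m⊔n (δ π) (δ π′)) (tm-weight π h))
          (scale-≤ (size u) (m≤n⊔m (δ π) (δ π′)) (tm-weight π′ h)))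
    cmd-weight (cut {p = neg} {t} {u} π π′ _) h =
      scale-suc (size u + size t) (1≤N^ (δ π ⊔ δ π′))
        (scale-+ (size u) (size t) (N ^ (δ π ⊔ δ π′))
          (scale-≤ (size u) (m≤n⊔m (δ π) (δ π′)) (tm-weight π′ h))
          (scale-≤ (size t) (m≤m⊔n (δ π) (δ π′)) (tm-weight π h)))
    cmd-weight (conv κ _ π) h = cmd-weight π h
    cmd-weight (weak κ A _ π) h = cmd-weight π h

    -- The additional 1 is the symbol of the command that cuts `t` against the fresh variable; that
    -- variable itself weighs 0.
    tm-normalizes : ∀ {Θ p} {t : Tm [] p} {A : Form Θ p} {Γ} (π : ⊢ t ∶ A ∣ Γ) → size t ≤ N →
                    NormalizesWithin (1 + size t * N ^ δ π) t
    tm-normalizes {p = p} {t} π ≤N = normalizesWithin _ ⟨ renTm there t ∣ _ ⟩ (soft p t st) (w≤ p t wt)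
      where
      st = softTm-ren there t (tm-soft π ≤N)
      wt : wtTm 1 𝟘 (renTm there t) ≤ size t * N ^ δ π
      wt = ≤-trans (≤-reflexive (wtTm-ren there t)) (tm-weight π (λ _ → refl))
      -- The command unfolds only once `p` is known, hence the case distinction on polarity here and
      -- in `w≤`.
      soft : ∀ p (t : Tm [] p) → softTm (renTm {S′ = opp p ∷ []} there t) →
             softCmd ⟨ renTm there t ∣ val (var (here refl)) ⟩
      soft pos t st = st , tt
      soft neg t st = tt , st
      w≤ : ∀ p (t : Tm [] p) {m} → wtTm 1 𝟘 (renTm {S′ = opp p ∷ []} there t) ≤ m →
           weight ⟨ renTm there t ∣ val (var (here refl)) ⟩ ≤ 1 + m
      w≤ pos t h = s≤s (≤-trans (≤-reflexive (+-identityʳ _)) h)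
      w≤ neg t h = s≤s h

-- The polynomials

monomial : ℕ → Polynomial
monomial k = replicate k 0 ++ 1 ∷ []

evalPoly-monomial : ∀ k n → evalPoly (monomial k) n ≡ n ^ k
evalPoly-monomial zero    n = cong suc (*-zeroʳ n)
evalPoly-monomial (suc k) n = cong (n *_) (evalPoly-monomial k n)

theorem67 : (K : Polarity → Set) → let open Calculus K in
    Σ[ P ∈ (ℕ → Polynomial) ] ((Θ : KCtx) (p : Polarity) (t : Tm [] p) (A : Form Θ p) (π : ⊢ t ∶ A ∣ ∅) →
    NormalizesWithin (evalPoly (P (δ π)) (size t)) t)
-- `P k` is the polynomial `1 + X * X ^ k`: the bound of `tm-normalizes` with `N = size t` and
-- `δ π = k`.
theorem67 K = (λ k → 1 ∷ monomial k) , λ Θ p t A π →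
  subst (λ m → Calculus.NormalizesWithin K (suc (size t * m)) t)
    (sym (evalPoly-monomial (δ π) (size t)))
    -- The base `size t` is nonzero because every term has a symbol; the `0` is an arbitrary value
    -- for the parameter `N` of the module containing `1≤size`.
    (Weight.tm-normalizes K (size t) {{>-nonZero (Weight.1≤size K 0 t)}} π ≤-refl)
  where open Calculus K
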